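{- Let $(p,l)$ be an irregular pair. For even $m\ge 2$ put $Q(m)=\operatorname{num}\!\left(\frac{B_m}{m}\right)\Big/\operatorname{num}\!\left(\frac{B_m}{m(m-1)}\right)$, and define \[ A(p)=\min_{k\in\mathbb{N}_0}\left\{\, m=l+k(p-1) \;:\; Q(m)=p \,\right\}. \] Then $A(p)=(l-1)p+1$ holds, and this is the smallest possible value, if and only if one of the following cases holds: (1) $l-1$ has no irregular prime factors; (2) every irregular prime divisor $q$ of $l-1$ satisfies $q\nmid B_{(l-1)p+1}/((l-1)p+1)$ (i.e. $q$ does not divide the numerator of this rational number).
   Context: $B_n$ denotes the $n$-th Bernoulli number, defined by $\frac{z}{e^z-1}=\sum_{n\ge0}B_n\frac{z^n}{n!}$. For a rational number $r$, $\operatorname{num}(r)$ is its numerator (in lowest terms). For an odd prime $p$, a pair $(p,l)$ is an irregular pair if $l$ is even, $2\le l\le p-3$ and $p\mid B_l$. An odd prime $p$ is irregular if there is at least one irregular pair $(p,l)$. -}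

module Defs where

open import Data.Nat as ℕ using (ℕ; zero; suc; _∸_; _!)
open import Data.Nat.Properties using (_!≢0) renaming (+-identityʳ to ℕ+-identityʳ)
import Data.Nat.Divisibility as ℕ
open import Data.Nat.Primality using (Prime)
open import Data.Integer as ℤ using (ℤ; +_; +0; +[1+_]; -[1+_])
import Data.Integer.Properties as ℤ
import Data.Integer.Divisibility as ℤ
open import Data.Rational using (ℚ; mkℚ; 0ℚ; 1ℚ; _+_; _*_; -_; _-_; _/_; _÷_; ↥_)
open import Data.Rational.Properties
open import Data.Fin using (Fin; zero; suc; toℕ)
open import Data.Vec using (Vec; []; _∷_; head; lookup)
open import Data.Product using (∃; _×_; _,_)
open import Algebra.Bundles using (module CommutativeRing)
open import Algebra.Properties.CommutativeMonoid.Sum +-0-commutativeMonoid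
  using (sum-cong-≗; sum-syntax)
open import Relation.Nullary using (¬_)
open import Relation.Unary using (Pred)
open import Relation.Binary.PropositionalEquality
  using (_≡_; _≗_; refl; sym; trans; cong; cong₂; module ≡-Reasoning)
open import Level using (0ℓ)

-- Formal power series over ℚ, as coefficient sequences.

Series : Set
Series = ℕ → ℚ

one : Series
one zero    = 1ℚ
one (suc _) = 0ℚ

z : Series
z 1 = 1ℚ
z _ = 0ℚ

infixl 6 _⊖_
infixl 7 _⊛_

_⊖_ : Series → Series → Series
(f ⊖ g) n = f n - g n

_⊛_ : Series → Series → Series
(f ⊛ g) n = ∑[ k < suc n ] (f (toℕ k) * g (n ∸ toℕ k))

1/_! : ℕ → ℚ
1/ n ! = (+ 1 / (n !)) {{n !≢0}}

exp : Series
exp n = 1/ n !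

egf : (ℕ → ℚ) → Series
egf a n = a n * 1/ n !

-- prefix f n lists the first n coefficients of the reciprocal of f, highest
-- index first, for a series f with constant coefficient 1.

prefix : Series → (n : ℕ) → Vec ℚ n
prefix f zero          = []
prefix f (suc zero)    = 1ℚ ∷ []
prefix f (suc (suc n)) =
  - (∑[ i < suc n ] (f (suc (toℕ i)) * lookup (prefix f (suc n)) i))
  ∷ prefix f (suc n)

recip : Series → Series
recip f n = head (prefix f (suc n))

-- (e^z − 1)/z

[exp-1]/z : Series
[exp-1]/z n = 1/ (suc n) !

B : ℕ → ℚ
B n = (+ (n !) / 1) * recip [exp-1]/z n

-- B is the sequence defined by z/(e^z − 1) = Σ Bₙ zⁿ/n!; this is proved as
-- bernoulli-egf below.

private
  open ≡-Reasoning
  open CommutativeRing +-*-commutativeRing using (zeroˡ)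

  lookup-prefix : ∀ f n (i : Fin (suc n)) →
                  lookup (prefix f (suc n)) i ≡ recip f (n ∸ toℕ i)
  lookup-prefix f zero    zero    = refl
  lookup-prefix f (suc n) zero    = refl
  lookup-prefix f (suc n) (suc i) = lookup-prefix f n i

  !*1/! : ∀ n → (+ (n !) / 1) * 1/ n ! ≡ 1ℚ
  !*1/! n = go (n !) {{n !≢0}}
    where
    open import Data.Rational.Unnormalised as ℚᵘ using (mkℚᵘ; *≡*)
    import Data.Rational.Unnormalised.Properties as ℚᵘ
    go : ∀ m .{{_ : ℕ.NonZero m}} → (+ m / 1) * (+ 1 / m) ≡ 1ℚ
    go m@(suc m-1) = toℚᵘ-injective (ℚᵘ.≃-trans
      (toℚᵘ-homo-* (+ m / 1) (+ 1 / m))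
      (ℚᵘ.≃-trans
        (ℚᵘ.*-cong (toℚᵘ-fromℚᵘ (mkℚᵘ (+ m) 0)) (toℚᵘ-fromℚᵘ (mkℚᵘ (+ 1) m-1)))
        (*≡* (trans (ℤ.*-identityʳ _) (trans (ℤ.*-identityʳ (+ m))
          (sym (trans (ℤ.*-identityˡ _) (cong +_ (ℕ+-identityʳ m)))))))))
  egf-B : egf B ≗ recip [exp-1]/z
  egf-B n = begin
    (+ (n !) / 1) * r * 1/ n !    ≡⟨ cong (_* 1/ n !) (*-comm (+ (n !) / 1) r) ⟩
    r * (+ (n !) / 1) * 1/ n !    ≡⟨ *-assoc r (+ (n !) / 1) (1/ n !) ⟩
    r * ((+ (n !) / 1) * 1/ n !)  ≡⟨ cong (r *_) (!*1/! n) ⟩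
    r * 1ℚ                        ≡⟨ *-identityʳ r ⟩
    r                             ∎
    where
    r : ℚ
    r = recip [exp-1]/z n

recip-inverse : ∀ f → f 0 ≡ 1ℚ → f ⊛ recip f ≗ one
recip-inverse f f0 zero = trans (+-identityʳ (f 0 * 1ℚ)) (trans (*-identityʳ (f 0)) f0)
recip-inverse f f0 (suc n) = begin
  f 0 * - S + ∑[ i < suc n ] (f (suc (toℕ i)) * recip f (n ∸ toℕ i))
    ≡⟨ cong₂ _+_ (trans (cong (_* - S) f0) (*-identityˡ (- S)))
         (sum-cong-≗ {suc n} λ i → cong (f (suc (toℕ i)) *_) (sym (lookup-prefix f n i))) ⟩
  - S + S
    ≡⟨ +-inverseˡ S ⟩
  0ℚ ∎
  where
  S : ℚ
  S = ∑[ i < suc n ] (f (suc (toℕ i)) * lookup (prefix f (suc n)) i)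

bernoulli-egf : (exp ⊖ one) ⊛ egf B ≗ z
bernoulli-egf zero = refl
bernoulli-egf (suc n) = begin
  0ℚ * egf B (suc n) + ∑[ i < suc n ] ((exp (suc (toℕ i)) - 0ℚ) * egf B (n ∸ toℕ i))
    ≡⟨ trans (cong (_+ T) (zeroˡ (egf B (suc n)))) (+-identityˡ T) ⟩
  ∑[ i < suc n ] ((exp (suc (toℕ i)) - 0ℚ) * egf B (n ∸ toℕ i))
    ≡⟨ sum-cong-≗ {suc n} (λ i → cong₂ _*_ (+-identityʳ (exp (suc (toℕ i)))) (egf-B (n ∸ toℕ i))) ⟩
  ([exp-1]/z ⊛ recip [exp-1]/z) n
    ≡⟨ recip-inverse [exp-1]/z refl n ⟩
  one n
    ≡⟨ one≡z n ⟩
  z (suc n) ∎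
  where
  T : ℚ
  T = ∑[ i < suc n ] ((exp (suc (toℕ i)) - 0ℚ) * egf B (n ∸ toℕ i))
  one≡z : ∀ k → one k ≡ z (suc k)
  one≡z zero    = refl
  one≡z (suc _) = refl

-- Total division, with the junk value x ÷₀ 0 = 0.  Below, the divisors that
-- occur for even m ≥ 2 are never zero, because then Bₘ ≠ 0.

infixl 7 _÷₀_

_÷₀_ : ℚ → ℚ → ℚ
x ÷₀ mkℚ +0 _ _           = 0ℚ
x ÷₀ y@(mkℚ +[1+ _ ] _ _) = x ÷ y
x ÷₀ y@(mkℚ -[1+ _ ] _ _) = x ÷ y

fromℤ : ℤ → ℚ
fromℤ i = i / 1

fromℕ : ℕ → ℚ
fromℕ n = fromℤ (+ n)

num : ℚ → ℤ
num = ↥_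

Q : ℕ → ℚ
Q m = fromℤ (num (B m ÷₀ fromℕ m)) ÷₀ fromℤ (num (B m ÷₀ fromℕ (m ℕ.* (m ∸ 1))))

-- A natural number divides a rational number when it divides its numerator.

infix 4 _∣num_

_∣num_ : ℕ → ℚ → Set
q ∣num r = + q ℤ.∣ num r

OddPrime : ℕ → Set
OddPrime p = Prime p × ¬ 2 ℕ.∣ p

IrregularPair : ℕ → ℕ → Set
IrregularPair p l = OddPrime p × 2 ℕ.∣ l × 2 ℕ.≤ l × l ℕ.≤ p ∸ 3 × p ∣num B l

IrregularPrime : ℕ → Set
IrregularPrime p = OddPrime p × ∃ λ l → IrregularPair p l

IsMin : Pred ℕ 0ℓ → ℕ → Set
IsMin S a = S a × (∀ m → S m → a ℕ.≤ m)

-- The set over which A(p) is the minimum.  It depends on l as well, and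
-- it is not assumed to be inhabited, so "A(p) = a" is IsMin (ASet p l) a.

ASet : ℕ → ℕ → Pred ℕ 0ℓ
ASet p l m = (∃ λ k → m ≡ l ℕ.+ k ℕ.* (p ∸ 1)) × Q m ≡ fromℕ p

module Submission where

-- Writing Bₘ/m = N/D ≠ 0 in lowest terms, Q(m) = gcd(N, m − 1).  So Q(m) = p forces
-- p ∣ m − 1, which for m = l + k(p−1) means k ≡ l − 1 (mod p), whence m ≥ X.
-- Kummer's congruence gives p ∣ num(B_X/X), so Q(X) = p unless some other prime
-- q ∣ l − 1 divides num(B_X/X); by von Staudt–Clausen and Kummer such a q is
-- irregular.
--
-- Both classical facts are read off from the power sums Sₘ = Σ_{a<p} aᵐ.
-- Faulhaber's formula gives Sₘ ≡ pBₘ modulo p, and modulo p² for even m and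
-- p ≥ 5; Voronoi's argument, Σⱼ (aj)ᵐ against Σⱼ (aj mod p)ᵐ modulo p², shows
-- that p² ∣ Sₘ depends only on m mod p − 1.

open import Defs

-- Kummer's congruence enters in this form: between even indices that are congruent modulo p - 1 and
-- not multiples of p - 1, p ∣ B passes from one to the other, provided p does not divide the
-- starting index. Its carrier is Voronoi's congruence (aᵐ - 1)Sₘ ≡ pmW (mod p²), where W = Σⱼ
-- ⌊aj/p⌋(aj mod p)ᵐ⁻¹ modulo p depends only on m mod p - 1. One a with aᵐ ≢ 1 (mod p) suffices, and
-- p ∣ Sₘ supplies it: if aᵐ ≡ 1 for all nonzero a, then Sₘ ≡ -1.
--
-- The obstacle is passing from Sₘ to pBₘ modulo p². The Faulhaber term C(m,j) pʲ⁺¹/(j+1) Bₘ₋ⱼ may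
-- lose one p to Bₘ₋ⱼ and more to j + 1. For j ≥ 2 and p ≥ 5 enough is left. For j = 1 the term is
-- safe only once Bₘ₋₁ is known to be p-integral, which holds because m - 1 is odd and p - 1 even.
-- So integrality has to precede Kummer.
--
-- The numerators of B_X and B_X/X agree as far as the primes in play are concerned: p and every q ∣
-- l - 1 divide X - 1, hence not X.

module PowerSum where

  open import Data.Nat
  open import Data.Nat.Properties
  open import Data.Nat.Divisibility
  open import Data.Nat.DivMod
  open import Data.Nat.Primality using (Prime; euclidsLemma; prime⇒nonZero; ¬prime[1])
  open import Data.Nat.Combinatorics using (_C_; nCk≡n!/k![n-k]!; nCn≡1; k![n∸k]!∣n!)
  open import Data.Nat.Solver using (module +-*-Solver)
  open import Data.Fin using (Fin; zero; suc; toℕ; fromℕ<)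
  open import Data.Fin.Properties using (toℕ<n; toℕ-fromℕ<; toℕ-injective; ¬∀⟶∃¬)
  open import Data.Fin.Permutation using (Permutation; permutation)
  open import Data.Product using (∃; _×_; _,_)
  open import Data.Sum using (inj₁; inj₂; [_,_]′)
  open import Function using (_∘_)
  open import Relation.Nullary using (¬_; contradiction)
  open import Relation.Binary.PropositionalEquality
  import Algebra.Properties.CommutativeSemiring.Binomial +-*-commutativeSemiring as Binomial
  open import Algebra.Properties.Semiring.Sum +-*-semiring
  import Algebra.Definitions.RawSemiring +-*-rawSemiring as Raw
  open import Algebra.Definitions.RawMonoid +-0-rawMonoid using () renaming (_×_ to _·_)
  open +-*-Solver using (solve; _:=_; _:+_; _:*_; con)

  -- Binomial coefficients and finite sums of naturals

  nCk*k!*[n∸k]! : ∀ {n k} → k ≤ n → (n C k) * (k ! * (n ∸ k) !) ≡ n !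
  nCk*k!*[n∸k]! {n} {k} k≤n = trans (cong (_* (k ! * (n ∸ k) !)) (nCk≡n!/k![n-k]! k≤n))
    (m/n*n≡m (k![n∸k]!∣n! k≤n))
    where instance _ = k !* (n ∸ k) !≢0

  [1+a]^n : ∀ a n → suc a ^ n ≡ ∑[ k < suc n ] ((n C toℕ k) * a ^ (n ∸ toℕ k))
  [1+a]^n a n = begin
    suc a ^ n                                                        ≡⟨ ^≡ (suc a) n ⟩
    suc a Raw.^ n                                                    ≡⟨ Binomial.theorem n 1 a ⟩
    ∑[ k < suc n ] ((n C toℕ k) · (1 Raw.^ toℕ k * a Raw.^ (n ∸ toℕ k)))
      ≡⟨ sum-cong-≗ {suc n} (λ k → trans (·≡ (n C toℕ k) _) (cong ((n C toℕ k) *_)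
           (trans (cong₂ _*_ (trans (sym (^≡ 1 (toℕ k))) (^-zeroˡ (toℕ k))) (sym (^≡ a (n ∸ toℕ k))))
                  (*-identityˡ _)))) ⟩
    ∑[ k < suc n ] ((n C toℕ k) * a ^ (n ∸ toℕ k))                     ∎
    where
    open ≡-Reasoning
    ^≡ : ∀ x m → x ^ m ≡ x Raw.^ m
    ^≡ x zero    = refl
    ^≡ x (suc m) = cong (x *_) (^≡ x m)
    ·≡ : ∀ c x → c · x ≡ c * x
    ·≡ zero    x = refl
    ·≡ (suc c) x = cong (x +_) (·≡ c x)

  sum-last : ∀ n (g : ℕ → ℕ) → ∑[ k < suc n ] g (toℕ k) ≡ ∑[ k < n ] g (toℕ k) + g n
  sum-last zero    g = +-identityʳ (g 0)
  sum-last (suc n) g = trans (cong (g 0 +_) (sum-last n (g ∘ suc))) (sym (+-assoc (g 0) _ _))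

  ∣-sum : ∀ {d} n (g : Fin n → ℕ) → (∀ i → d ∣ g i) → d ∣ sum g
  ∣-sum zero    g h = _ ∣0
  ∣-sum (suc n) g h = ∣m∣n⇒∣m+n (h zero) (∣-sum n (g ∘ suc) (h ∘ suc))

  -- Congruence modulo d restricted to x ≤ y, so that everything stays in ℕ.

  infix 4 _≤[_]_

  _≤[_]_ : ℕ → ℕ → ℕ → Set
  x ≤[ d ] y = ∃ λ k → y ≡ x + k * d

  module _ {d : ℕ} where

    ≤[]-refl : ∀ {x} → x ≤[ d ] x
    ≤[]-refl {x} = 0 , sym (+-identityʳ x)

    ≤[]-trans : ∀ {x y w} → x ≤[ d ] y → y ≤[ d ] w → x ≤[ d ] w
    ≤[]-trans {x} (k , refl) (l , refl) = k + l ,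
      solve 4 (λ x k l d → x :+ k :* d :+ l :* d := x :+ (k :+ l) :* d) refl x k l d

    ≤[]-+ : ∀ {x y x′ y′} → x ≤[ d ] y → x′ ≤[ d ] y′ → x + x′ ≤[ d ] y + y′
    ≤[]-+ {x} {_} {x′} (k , refl) (l , refl) = k + l ,
      solve 5 (λ x x′ k l d → x :+ k :* d :+ (x′ :+ l :* d) := x :+ x′ :+ (k :+ l) :* d) refl x x′ k l d

    ≤[]-* : ∀ {x y x′ y′} → x ≤[ d ] y → x′ ≤[ d ] y′ → x * x′ ≤[ d ] y * y′
    ≤[]-* {x} {_} {x′} (k , refl) (l , refl) = x * l + k * (x′ + l * d) ,
      solve 5 (λ x x′ k l d → (x :+ k :* d) :* (x′ :+ l :* d)
        := x :* x′ :+ (x :* l :+ k :* (x′ :+ l :* d)) :* d) refl x x′ k l d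

    ≤[]-^ : ∀ {x y} n → x ≤[ d ] y → x ^ n ≤[ d ] y ^ n
    ≤[]-^ zero    h = ≤[]-refl
    ≤[]-^ (suc n) h = ≤[]-* h (≤[]-^ n h)

    ≤[]-sum : ∀ n (g h : Fin n → ℕ) → (∀ i → g i ≤[ d ] h i) → sum g ≤[ d ] sum h
    ≤[]-sum zero    g h _ = ≤[]-refl
    ≤[]-sum (suc n) g h r = ≤[]-+ (r zero) (≤[]-sum n (g ∘ suc) (h ∘ suc) (r ∘ suc))

    ∣-≤[] : ∀ {x y} → x ≤[ d ] y → d ∣ x → d ∣ y
    ∣-≤[] (k , refl) d∣x = ∣m∣n⇒∣m+n d∣x (n∣m*n k)

    ∣-≤[]⁻ : ∀ {x y} → x ≤[ d ] y → d ∣ y → d ∣ x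
    ∣-≤[]⁻ {x} (k , refl) d∣y = ∣m+n∣m⇒∣n (subst (d ∣_) (+-comm x (k * d)) d∣y) (n∣m*n k)

    ≤[]-∣ : ∀ {x y} → d ∣ y → x ≤[ d ] x + y
    ≤[]-∣ {x} (divides k eq) = k , cong (x +_) eq

    ≤[]-∸ : ∀ {x y} → x ≤ y → d ∣ y ∸ x → x ≤[ d ] y
    ≤[]-∸ {x} x≤y d∣ = subst (x ≤[ d ]_) (m+[n∸m]≡n x≤y) (≤[]-∣ d∣)

  -- Power sums modulo a prime

  powerSum : ℕ → ℕ → ℕ
  powerSum n m = ∑[ a < n ] (toℕ a ^ m)

  prime⇒nonZero-pred : ∀ {n} → Prime (suc n) → NonZero n
  prime⇒nonZero-pred {zero}  pPrime = contradiction pPrime ¬prime[1]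
  prime⇒nonZero-pred {suc n} pPrime = _

  module _ {n : ℕ} (pPrime : Prime (suc n)) where

    private
      p : ℕ
      p = suc n
      instance
        n≢0 : NonZero n
        n≢0 = prime⇒nonZero-pred pPrime

    p∤suc : ∀ {i} → i < n → ¬ p ∣ suc i
    p∤suc i<n = >⇒∤ (s<s i<n)

    p∤k! : ∀ k → k ≤ n → ¬ p ∣ k !
    p∤k! zero    _ p∣1 = contradiction (∣1⇒≡1 p∣1) λ { refl → ¬prime[1] pPrime }
    p∤k! (suc k) k<n p∣ = [ p∤suc k<n , p∤k! k (<⇒≤ k<n) ]′ (euclidsLemma (suc k) (k !) pPrime p∣)

    p∣pCk : ∀ {k} → k < n → p ∣ p C suc k
    p∣pCk {k} k<n with euclidsLemma (p C suc k) (suc k ! * (n ∸ k) !) pPrime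
      (subst (p ∣_) (sym (nCk*k!*[n∸k]! {p} {suc k} (s≤s (<⇒≤ k<n)))) (m∣m*n (n !)))
    ... | inj₁ p∣C = p∣C
    ... | inj₂ p∣f = contradiction p∣f λ p∣f → [ p∤k! (suc k) k<n , p∤k! (n ∸ k) (m∸n≤m n k) ]′
      (euclidsLemma (suc k !) ((n ∸ k) !) pPrime p∣f)

    fermat : ∀ a → a ≤[ p ] a ^ p
    fermat zero    = ≤[]-refl
    fermat (suc a) = ≤[]-trans step (subst (suc (a ^ p) ≤[ p ]_) (sym eq) (≤[]-∣ p∣M))
      where
      g : ℕ → ℕ
      g k = (p C k) * a ^ (p ∸ k)
      M : ℕ
      M = ∑[ k < n ] g (suc (toℕ k))
      p∣M : p ∣ M
      p∣M = ∣-sum n _ λ k → ∣m⇒∣m*n _ (p∣pCk (toℕ<n k))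
      step : suc a ≤[ p ] suc (a ^ p)
      step = ≤[]-+ (≤[]-refl {x = 1}) (fermat a)
      g0 : g 0 ≡ a ^ p
      g0 = *-identityˡ (a ^ p)
      gp : g p ≡ 1
      gp = cong₂ _*_ (nCn≡1 p) (cong (a ^_) (n∸n≡0 p))
      eq : suc a ^ p ≡ suc (a ^ p) + M
      eq = begin
        suc a ^ p                              ≡⟨ [1+a]^n a p ⟩
        g 0 + ∑[ k < p ] g (suc (toℕ k))       ≡⟨ cong₂ _+_ g0 (sum-last n (g ∘ suc)) ⟩
        a ^ p + (M + g p)                      ≡⟨ cong (λ x → a ^ p + (M + x)) gp ⟩
        a ^ p + (M + 1)                        ≡⟨ solve 2 (λ x m → x :+ (m :+ con 1) := con 1 :+ x :+ m) refl (a ^ p) M ⟩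
        suc (a ^ p) + M                        ∎
        where open ≡-Reasoning

    -- Positive exponents keep this true when `p` divides `a`, so it can be summed over all
    -- residues. Each extra `n` in the exponent is one use of `fermat`, replacing a factor `a` by
    -- `a ^ p`.
    ^-periodic : ∀ a m k → a ^ suc m ≤[ p ] a ^ suc (m + k * n)
    ^-periodic a m zero    = subst (λ e → a ^ suc m ≤[ p ] a ^ suc e) (sym (+-identityʳ m)) ≤[]-refl
    ^-periodic a m (suc k) = ≤[]-trans (^-periodic a m k)
      (subst₂ _≤[ p ]_ (*-comm _ a) eq (≤[]-* (≤[]-refl {x = a ^ (m + k * n)}) (fermat a)))
      where
      eq : a ^ (m + k * n) * a ^ p ≡ a ^ suc (m + suc k * n)
      eq = trans (sym (^-distribˡ-+-* a (m + k * n) p)) (cong (a ^_)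
        (solve 3 (λ m kn n → m :+ kn :+ (con 1 :+ n) := con 1 :+ (m :+ (n :+ kn))) refl m (k * n) n))

    a^n≡1 : ∀ {i} → i < n → 1 ≤[ p ] suc i ^ n
    a^n≡1 {i} i<n = ≤[]-∸ (m^n>0 (suc i) n) (go (fermat (suc i)))
      where
      go : suc i ≤[ p ] suc i ^ p → p ∣ suc i ^ n ∸ 1
      go (k , eq) with euclidsLemma (suc i) (suc i ^ n ∸ 1) pPrime
        (divides k (trans (*-distribˡ-∸ (suc i) (suc i ^ n) 1) (trans (cong₂ _∸_ eq (*-identityʳ (suc i)))
          (m+n∸m≡n (suc i) (k * p)))))
      ... | inj₁ h = contradiction h (p∤suc i<n)
      ... | inj₂ h = h

    powerSum-periodic : ∀ m k → powerSum p (suc m) ≤[ p ] powerSum p (suc (m + k * n))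
    powerSum-periodic m k = ≤[]-sum p _ _ λ a → ^-periodic (toℕ a) m k

    -- The term for 0 vanishes because the exponent is positive, so the sum is congruent to `n`,
    -- which lies strictly between 0 and `p`.
    powerSum-trivial : ∀ m → (∀ (i : Fin n) → 1 ≤[ p ] suc (toℕ i) ^ suc m) → ¬ p ∣ powerSum p (suc m)
    powerSum-trivial m h p∣S = go (∣-≤[]⁻ (≤[]-sum n (λ _ → 1) _ h) p∣S)
      where
      sum-1 : ∀ k → sum {k} (λ _ → 1) ≡ k
      sum-1 zero    = refl
      sum-1 (suc k) = cong suc (sum-1 k)
      go : ¬ p ∣ sum {n} (λ _ → 1)
      go h = >⇒∤ ≤-refl (subst (p ∣_) (sum-1 n) h)

    p∤powerSum : ∀ k → ¬ p ∣ powerSum p (n + k * n)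
    p∤powerSum k = go pPrime refl
      where
      go : ∀ {m} → .{{NonZero m}} → Prime (suc m) → m ≡ n → ¬ p ∣ powerSum p (m + k * n)
      -- Naming `n` as `suc m` exposes the exponent as a successor, the form that
      -- `powerSum-periodic` speaks about.
      go {suc m} _ refl p∣ = powerSum-trivial m (λ i → a^n≡1 (toℕ<n i)) (∣-≤[]⁻ (powerSum-periodic m k) p∣)

    -- Supplies the base for Voronoi's argument: were `a ^ suc m` congruent to 1 for every nonzero
    -- `a`, the power sum would be `n` modulo `p`. The search runs over finitely many decidable
    -- cases.
    nontrivial-power : ∀ m → p ∣ powerSum p (suc m) → ∃ λ i → i < n × ¬ p ∣ suc i ^ suc m ∸ 1
    nontrivial-power m p∣S with ¬∀⟶∃¬ n _ (λ (i : Fin n) → p ∣? suc (toℕ i) ^ suc m ∸ 1)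
      (λ h → powerSum-trivial m (λ i → ≤[]-∸ (m^n>0 (suc (toℕ i)) (suc m)) (h i)) p∣S)
    ... | i , h = toℕ i , toℕ<n i , h

  -- Voronoi's congruence modulo p²

  module _ {p : ℕ} .{{_ : NonZero p}} where

    *%-inverse : ∀ {a b} → 1 ≤[ p ] b * a → ∀ {j} → j < p → (b * (a * j % p)) % p ≡ j
    *%-inverse {a} {b} (k , ba≡1) {j} j<p = begin
      (b * (a * j % p)) % p             ≡⟨ %-distribˡ-* b (a * j % p) p ⟩
      ((b % p) * (a * j % p % p)) % p   ≡⟨ cong (λ x → ((b % p) * x) % p) (m%n%n≡m%n (a * j) p) ⟩
      ((b % p) * (a * j % p)) % p       ≡⟨ %-distribˡ-* b (a * j) p ⟨
      (b * (a * j)) % p                 ≡⟨ cong (_% p) (sym (*-assoc b a j)) ⟩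
      (b * a * j) % p                   ≡⟨ cong (λ x → (x * j) % p) ba≡1 ⟩
      ((1 + k * p) * j) % p             ≡⟨ cong (_% p) (solve 3 (λ k p j → (con 1 :+ k :* p) :* j := j :+ k :* j :* p) refl k p j) ⟩
      (j + k * j * p) % p               ≡⟨ [m+kn]%n≡m%n j (k * j) p ⟩
      j % p                             ≡⟨ m<n⇒m%n≡m j<p ⟩
      j                                 ∎
      where open ≡-Reasoning

    -- The inverse `b` makes multiplication by `a` a permutation of the residues, so the sum is
    -- merely reordered.
    sum-*% : ∀ {a b} → 1 ≤[ p ] a * b → (g : ℕ → ℕ) → ∑[ j < p ] g (a * toℕ j % p) ≡ ∑[ j < p ] g (toℕ j)
    sum-*% {a} {b} ab≡1 g = begin
      ∑[ j < p ] g (a * toℕ j % p)  ≡⟨ sum-cong-≗ {p} (λ j → cong g (sym (toℕ-mul a j))) ⟩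
      ∑[ j < p ] g (toℕ (mul a j))  ≡⟨ sum-permute (g ∘ toℕ) π ⟨
      ∑[ j < p ] g (toℕ j)          ∎
      where
      open ≡-Reasoning
      mul : ℕ → Fin p → Fin p
      mul c j = fromℕ< (m%n<n (c * toℕ j) p)
      toℕ-mul : ∀ c j → toℕ (mul c j) ≡ c * toℕ j % p
      toℕ-mul c j = toℕ-fromℕ< _
      mul-inverse : ∀ {c d} → 1 ≤[ p ] d * c → ∀ j → mul d (mul c j) ≡ j
      mul-inverse {c} {d} dc≡1 j = toℕ-injective (trans (toℕ-mul d (mul c j))
        (trans (cong (λ x → d * x % p) (toℕ-mul c j)) (*%-inverse {c} {d} dc≡1 (toℕ<n j))))
      π : Permutation p p
      π = permutation (mul a) (mul b) (mul-inverse {b} {a} ab≡1)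
        (mul-inverse {a} {b} (subst (1 ≤[ p ]_) (*-comm a b) ab≡1))

    powerSum-*% : ∀ {a b} → 1 ≤[ p ] a * b → ∀ m → ∑[ j < p ] ((a * toℕ j % p) ^ m) ≡ powerSum p m
    powerSum-*% {a} {b} ab≡1 m = sum-*% {a} {b} ab≡1 (_^ m)

  ^-first-order : ∀ p x q m → x ^ suc m + p * (suc m * (q * x ^ m)) ≤[ p * p ] (x + q * p) ^ suc m
  ^-first-order p x q zero = 0 , solve 3 (λ x p q →
    (x :+ q :* p) :* con 1 := x :* con 1 :+ p :* (con 1 :* (q :* con 1)) :+ con 0 :* (p :* p)) refl x p q
  ^-first-order p x q (suc m) = ≤[]-trans
    (suc m * (q * (q * x ^ m)) ,
      solve 5 (λ x p q X m → (x :+ q :* p) :* (x :* X :+ p :* ((con 1 :+ m) :* (q :* X)))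
        := x :* (x :* X) :+ p :* ((con 2 :+ m) :* (q :* (x :* X)))
           :+ (con 1 :+ m) :* (q :* (q :* X)) :* (p :* p)) refl x p q (x ^ m) m)
    (≤[]-* (≤[]-refl {x = x + q * p}) (^-first-order p x q m))

  ^-distribʳ-* : ∀ m x y → (x * y) ^ m ≡ x ^ m * y ^ m
  ^-distribʳ-* zero    x y = refl
  ^-distribʳ-* (suc m) x y = trans (cong (x * y *_) (^-distribʳ-* m x y))
    (solve 4 (λ x y X Y → x :* y :* (X :* Y) := x :* X :* (y :* Y)) refl x y (x ^ m) (y ^ m))

  p^e∣c*s⇒p^e∣s : ∀ {p c s} → Prime p → ¬ p ∣ c → ∀ e → p ^ e ∣ c * s → p ^ e ∣ s
  p^e∣c*s⇒p^e∣s {p} {c} {s} pPrime p∤c zero    _ = 1∣ s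
  p^e∣c*s⇒p^e∣s {p} {c} {s} pPrime p∤c (suc e) h = go (p^e∣c*s⇒p^e∣s {c = c} pPrime p∤c e (∣-trans (n∣m*n p) h))
    where
    instance
      _ = prime⇒nonZero pPrime
      _ = m^n≢0 p e
    go : p ^ e ∣ s → p ^ suc e ∣ s
    go (divides t refl) = *-monoˡ-∣ (p ^ e) ([ (λ p∣c → contradiction p∣c p∤c) , (λ p∣t → p∣t) ]′
      (euclidsLemma c t pPrime (*-cancelʳ-∣ (p ^ e) (subst (p ^ suc e ∣_) (sym (*-assoc c t (p ^ e))) h))))

  p²∣c*s⇒p²∣s : ∀ {p c s} → Prime p → ¬ p ∣ c → p * p ∣ c * s → p * p ∣ s
  p²∣c*s⇒p²∣s {p} {c} {s} pPrime p∤c h = subst (_∣ s) p²≡ (p^e∣c*s⇒p^e∣s {c = c} pPrime p∤c 2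
    (subst (_∣ c * s) (sym p²≡) h))
    where
    p²≡ : p ^ 2 ≡ p * p
    p²≡ = cong (p *_) (*-identityʳ p)

  module _ {n : ℕ} (pPrime : Prime (suc n)) where

    private
      p : ℕ
      p = suc n
      instance
        n≢0 : NonZero n
        n≢0 = prime⇒nonZero-pred pPrime

    -- The first-order coefficient when `(a * j) ^ suc m` is expanded around the residue of `a * j`;
    -- hence an exponent one below that of the power sum it accompanies.
    voronoiSum : ℕ → ℕ → ℕ
    voronoiSum a m = ∑[ j < p ] (a * toℕ j / p * (a * toℕ j % p) ^ m)

    -- Write aj = r + qp with r = aj % p, expand (r + qp)ᵐ modulo p², and sum over
    -- j: multiplication by a permutes the residues r.
    voronoi : ∀ {i} → i < n → ∀ m → let a = suc i in
      powerSum p (suc m) + p * (suc m * voronoiSum a m) ≤[ p * p ] a ^ suc m * powerSum p (suc m)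
    voronoi {i} i<n m = subst₂ _≤[ p * p ]_ lhs rhs
      (≤[]-sum p _ _ λ j → subst (λ x → r j ^ suc m + p * (suc m * (q j * r j ^ m)) ≤[ p * p ] x ^ suc m)
        (sym (m≡m%n+[m/n]*n (a * toℕ j) p)) (^-first-order p (r j) (q j) m))
      where
      open ≡-Reasoning
      a : ℕ
      a = suc i
      q r : Fin p → ℕ
      q j = a * toℕ j / p
      r j = a * toℕ j % p
      a*b≡1 : 1 ≤[ p ] a * a ^ pred n
      a*b≡1 = subst (λ e → 1 ≤[ p ] a ^ e) (sym (suc-pred n)) (a^n≡1 pPrime i<n)
      lhs : ∑[ j < p ] (r j ^ suc m + p * (suc m * (q j * r j ^ m)))
          ≡ powerSum p (suc m) + p * (suc m * voronoiSum a m)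
      lhs = begin
        ∑[ j < p ] (r j ^ suc m + p * (suc m * (q j * r j ^ m)))
          ≡⟨ ∑-distrib-+ {p} (λ j → r j ^ suc m) (λ j → p * (suc m * (q j * r j ^ m))) ⟩
        ∑[ j < p ] (r j ^ suc m) + ∑[ j < p ] (p * (suc m * (q j * r j ^ m)))
          ≡⟨ cong₂ _+_ (powerSum-*% {p} {a} a*b≡1 (suc m)) (sym (trans
               (cong (p *_) (*-distribˡ-sum {p} (suc m) λ j → q j * r j ^ m))
               (*-distribˡ-sum {p} p λ j → suc m * (q j * r j ^ m)))) ⟩
        powerSum p (suc m) + p * (suc m * voronoiSum a m) ∎
      rhs : ∑[ j < p ] ((a * toℕ j) ^ suc m) ≡ a ^ suc m * powerSum p (suc m)
      rhs = begin
        ∑[ j < p ] ((a * toℕ j) ^ suc m)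
          ≡⟨ sum-cong-≗ {p} (λ j → ^-distribʳ-* (suc m) a (toℕ j)) ⟩
        ∑[ j < p ] (a ^ suc m * toℕ j ^ suc m)
          ≡⟨ *-distribˡ-sum {p} (a ^ suc m) (λ j → toℕ j ^ suc m) ⟨
        a ^ suc m * powerSum p (suc m) ∎

    voronoiSum-periodic : ∀ a m k → voronoiSum a (suc m) ≤[ p ] voronoiSum a (suc (m + k * n))
    voronoiSum-periodic a m k = ≤[]-sum p
      (λ j → a * toℕ j / p * (a * toℕ j % p) ^ suc m) (λ j → a * toℕ j / p * (a * toℕ j % p) ^ suc (m + k * n)) λ j →
      ≤[]-* (≤[]-refl {x = a * toℕ j / p}) (^-periodic pPrime (a * toℕ j % p) m k)

    module _ {i} (i<n : i < n) (m : ℕ) where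

      -- In (aᵐ⁺¹ - 1)S ≡ p(m+1)W modulo p² the left side vanishes, and `¬ p ∣ suc m` frees W.
      p²∣powerSum⇒p∣voronoiSum : ¬ p ∣ suc m → p * p ∣ powerSum p (suc m) → p ∣ voronoiSum (suc i) m
      p²∣powerSum⇒p∣voronoiSum p∤m p²∣S =
        [ (λ p∣m → contradiction p∣m p∤m) , (λ p∣W → p∣W) ]′ (euclidsLemma (suc m) _ pPrime
          (*-cancelˡ-∣ p (∣m+n∣m⇒∣n (∣-≤[]⁻ (voronoi i<n m) (∣n⇒∣m*n (suc i ^ suc m) p²∣S)) p²∣S)))

      -- The same congruence read the other way: the right side vanishes, and the unit
      -- `suc i ^ suc m ∸ 1` is cancelled.
      p∣voronoiSum⇒p²∣powerSum : ¬ p ∣ suc i ^ suc m ∸ 1 → p ∣ voronoiSum (suc i) m → p * p ∣ powerSum p (suc m)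
      p∣voronoiSum⇒p²∣powerSum p∤c p∣W = p²∣c*s⇒p²∣s pPrime p∤c (go (voronoi i<n m))
        where
        S = powerSum p (suc m)
        T = p * (suc m * voronoiSum (suc i) m)
        c = suc i ^ suc m ∸ 1
        p²∣T : p * p ∣ T
        p²∣T = *-monoʳ-∣ p (∣n⇒∣m*n (suc m) p∣W)
        go : S + T ≤[ p * p ] suc i ^ suc m * S → p * p ∣ c * S
        go (k , eq) = subst (p * p ∣_) (sym (+-cancelˡ-≡ S _ _ cS)) (∣m∣n⇒∣m+n p²∣T (n∣m*n k))
          where
          cS : S + c * S ≡ S + (T + k * (p * p))
          cS = trans (cong (_* S) (m+[n∸m]≡n (m^n>0 (suc i) (suc m)))) (trans eq (+-assoc S T _))

    private
      nontrivial-periodic : ∀ a m k → .{{NonZero a}} → ¬ p ∣ a ^ suc m ∸ 1 → ¬ p ∣ a ^ suc (m + k * n) ∸ 1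
      nontrivial-periodic a m k p∤ p∣ = p∤ (go (^-periodic pPrime a m k))
        where
        go : a ^ suc m ≤[ p ] a ^ suc (m + k * n) → p ∣ a ^ suc m ∸ 1
        go (l , eq) = ∣-≤[]⁻ (l , trans (cong (_∸ 1) eq) (+-∸-comm (l * p) (m^n>0 a (suc m)))) p∣

    module _ (m k : ℕ) (p∣S : p ∣ powerSum p (2 + m)) where

      -- One base serves both exponents, since its powers modulo `p` depend only on the exponent
      -- modulo `n`. Divisibility goes from S to W at the first exponent, across by periodicity of
      -- W, and back to S at the second. Starting at `2 + m` leaves W the positive exponent that its
      -- periodicity requires.
      p²∣powerSum-periodic : ¬ p ∣ 2 + m → p * p ∣ powerSum p (2 + m) → p * p ∣ powerSum p (2 + (m + k * n))
      p²∣powerSum-periodic p∤m p²∣S = go (nontrivial-power pPrime (suc m) p∣S)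
        where
        go : (∃ λ i → i < n × ¬ p ∣ suc i ^ (2 + m) ∸ 1) → _
        go (i , i<n , p∤c) = p∣voronoiSum⇒p²∣powerSum i<n (suc (m + k * n)) (nontrivial-periodic (suc i) (suc m) k p∤c)
          (∣-≤[] (voronoiSum-periodic (suc i) m k) (p²∣powerSum⇒p∣voronoiSum i<n (suc m) p∤m p²∣S))

      p²∣powerSum-periodic⁻ : ¬ p ∣ 2 + (m + k * n) → p * p ∣ powerSum p (2 + (m + k * n)) → p * p ∣ powerSum p (2 + m)
      p²∣powerSum-periodic⁻ p∤m p²∣S = go (nontrivial-power pPrime (suc m) p∣S)
        where
        go : (∃ λ i → i < n × ¬ p ∣ suc i ^ (2 + m) ∸ 1) → _
        go (i , i<n , p∤c) = p∣voronoiSum⇒p²∣powerSum i<n (suc m) p∤c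
          (∣-≤[]⁻ (voronoiSum-periodic (suc i) m k) (p²∣powerSum⇒p∣voronoiSum i<n (suc (m + k * n)) p∤m p²∣S))

-- Formal power series and Faulhaber's formula

module GeneratingFunction where

  open PowerSum using (powerSum; [1+a]^n; nCk*k!*[n∸k]!; sum-last)
  open import Data.Nat as ℕ using (ℕ; zero; suc; _∸_; _!; _^_)
  import Data.Nat.Properties as ℕ
  open import Data.Nat.Combinatorics using (_C_)
  open import Data.Integer as ℤ using (+_)
  import Data.Integer.Properties as ℤ
  open import Data.Rational using (ℚ; mkℚ; 0ℚ; 1ℚ; _+_; _*_; _/_; ↥_; ↧_; toℚᵘ)
  open import Data.Rational.Properties hiding (_≟_)
  open import Data.Rational.Unnormalised using (mkℚᵘ; *≡*; _≃_)
  import Data.Rational.Unnormalised.Properties as ℚᵘ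
  open import Data.Rational.Solver using (module +-*-Solver)
  open import Data.Fin using (Fin; zero; suc; toℕ)
  open import Data.Fin.Properties using (toℕ≤pred[n])
  open import Function using (_∘_)
  open import Relation.Binary.PropositionalEquality
  open import Algebra.Bundles using (module CommutativeRing)
  open CommutativeRing +-*-commutativeRing using (semiring; zeroˡ; zeroʳ)
  open import Algebra.Properties.Semiring.Sum semiring
  import Algebra.Properties.Semiring.Sum ℕ.+-*-semiring as ℕΣ
  open +-*-Solver using (solve; _:=_; _:+_; _:*_; con)
  open ≡-Reasoning

  toℚᵘ-fromℤ : ∀ i → toℚᵘ (fromℤ i) ≃ mkℚᵘ i 0
  toℚᵘ-fromℤ i = toℚᵘ-fromℚᵘ (mkℚᵘ i 0)

  fromℤ-injective : ∀ {i j} → fromℤ i ≡ fromℤ j → i ≡ j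
  fromℤ-injective {i} {j} eq with fromℚᵘ-injective {mkℚᵘ i 0} {mkℚᵘ j 0} eq
  ... | *≡* eq′ = ℤ.*-cancelʳ-≡ i j (+ 1) eq′

  fromℤ-+ : ∀ i j → fromℤ (i ℤ.+ j) ≡ fromℤ i + fromℤ j
  fromℤ-+ i j = toℚᵘ-injective (ℚᵘ.≃-trans (toℚᵘ-fromℤ (i ℤ.+ j)) (ℚᵘ.≃-sym
    (ℚᵘ.≃-trans (toℚᵘ-homo-+ (fromℤ i) (fromℤ j))
      (ℚᵘ.≃-trans (ℚᵘ.+-cong (toℚᵘ-fromℤ i) (toℚᵘ-fromℤ j))
        (*≡* (cong (ℤ._* + 1) (cong₂ ℤ._+_ (ℤ.*-identityʳ i) (ℤ.*-identityʳ j))))))))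

  fromℤ-* : ∀ i j → fromℤ (i ℤ.* j) ≡ fromℤ i * fromℤ j
  fromℤ-* i j = toℚᵘ-injective (ℚᵘ.≃-trans (toℚᵘ-fromℤ (i ℤ.* j)) (ℚᵘ.≃-sym
    (ℚᵘ.≃-trans (toℚᵘ-homo-* (fromℤ i) (fromℤ j))
      (ℚᵘ.≃-trans (ℚᵘ.*-cong (toℚᵘ-fromℤ i) (toℚᵘ-fromℤ j)) (*≡* refl)))))

  fromℕ-+ : ∀ m n → fromℕ (m ℕ.+ n) ≡ fromℕ m + fromℕ n
  fromℕ-+ m n = fromℤ-+ (+ m) (+ n)

  fromℕ-* : ∀ m n → fromℕ (m ℕ.* n) ≡ fromℕ m * fromℕ n
  fromℕ-* m n = trans (cong fromℤ (ℤ.pos-* m n)) (fromℤ-* (+ m) (+ n))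

  fromℕ-sum : ∀ n (g : Fin n → ℕ) → fromℕ (ℕΣ.sum g) ≡ sum (fromℕ ∘ g)
  fromℕ-sum zero    g = refl
  fromℕ-sum (suc n) g = trans (fromℕ-+ (g zero) _) (cong (_+_ (fromℕ (g zero))) (fromℕ-sum n (g ∘ suc)))

  ↧*q≡↥ : ∀ q → fromℤ (↧ q) * q ≡ fromℤ (↥ q)
  ↧*q≡↥ q@(mkℚ n d _) = toℚᵘ-injective (ℚᵘ.≃-trans (toℚᵘ-homo-* (fromℤ (↧ q)) q)
    (ℚᵘ.≃-trans (ℚᵘ.*-congʳ {toℚᵘ q} (toℚᵘ-fromℤ (↧ q)))
      (ℚᵘ.≃-trans (*≡* eq) (ℚᵘ.≃-sym (toℚᵘ-fromℤ n)))))
    where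
    eq : (+ suc d ℤ.* n) ℤ.* + 1 ≡ n ℤ.* + suc (d ℕ.+ 0)
    eq = trans (ℤ.*-identityʳ _) (trans (ℤ.*-comm (+ suc d) n) (cong (λ x → n ℤ.* + suc x) (sym (ℕ.+-identityʳ d))))

  ↥[1/n] : ∀ n .{{_ : ℕ.NonZero n}} → fromℕ n * (+ 1 / n) ≡ 1ℚ
  ↥[1/n] n@(suc n-1) = toℚᵘ-injective (ℚᵘ.≃-trans (toℚᵘ-homo-* (fromℕ n) (+ 1 / n))
    (ℚᵘ.≃-trans (ℚᵘ.*-cong (toℚᵘ-fromℤ (+ n)) (toℚᵘ-fromℚᵘ (mkℚᵘ (+ 1) n-1)))
      (*≡* (trans (ℤ.*-identityʳ _) (trans (ℤ.*-identityʳ (+ n))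
        (sym (trans (ℤ.*-identityˡ _) (cong +_ (ℕ.+-identityʳ n)))))))))

  n!*1/n! : ∀ n → fromℕ (n !) * 1/ n ! ≡ 1ℚ
  n!*1/n! n = ↥[1/n] (n !) {{n ℕ.!≢0}}

  -- The series (f - f₀)/z. By definition `(f ⊛ g) (suc n)` is `f 0 * g (suc n) + (tail f ⊛ g) n`,
  -- so the laws of `⊛` go by induction on the coefficient index.
  tail : Series → Series
  tail f n = f (suc n)

  ⊛-cong : ∀ {f f′ g g′} → f ≗ f′ → g ≗ g′ → f ⊛ g ≗ f′ ⊛ g′
  ⊛-cong f≗ g≗ n = sum-cong-≗ {suc n} λ k → cong₂ _*_ (f≗ (toℕ k)) (g≗ (n ∸ toℕ k))

  ⊛-+ʳ : ∀ f g h n → (f ⊛ λ k → g k + h k) n ≡ (f ⊛ g) n + (f ⊛ h) n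
  ⊛-+ʳ f g h n = trans
    (sum-cong-≗ {suc n} λ k → *-distribˡ-+ (f (toℕ k)) (g (n ∸ toℕ k)) (h (n ∸ toℕ k)))
    (∑-distrib-+ {suc n} (λ k → f (toℕ k) * g (n ∸ toℕ k)) λ k → f (toℕ k) * h (n ∸ toℕ k))

  ⊛-+ˡ : ∀ f g h n → ((λ k → f k + g k) ⊛ h) n ≡ (f ⊛ h) n + (g ⊛ h) n
  ⊛-+ˡ f g h n = trans
    (sum-cong-≗ {suc n} λ k → *-distribʳ-+ (h (n ∸ toℕ k)) (f (toℕ k)) (g (toℕ k)))
    (∑-distrib-+ {suc n} (λ k → f (toℕ k) * h (n ∸ toℕ k)) λ k → g (toℕ k) * h (n ∸ toℕ k))

  ⊛-*ˡ : ∀ c g h n → ((λ k → c * g k) ⊛ h) n ≡ c * (g ⊛ h) n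
  ⊛-*ˡ c g h n = trans
    (sum-cong-≗ {suc n} λ k → *-assoc c (g (toℕ k)) (h (n ∸ toℕ k)))
    (sym (*-distribˡ-sum {suc n} c λ k → g (toℕ k) * h (n ∸ toℕ k)))

  ⊛-assoc : ∀ f g h n → ((f ⊛ g) ⊛ h) n ≡ (f ⊛ (g ⊛ h)) n
  ⊛-assoc f g h zero    = solve 3 (λ a b c → (a :* b :+ con 0ℚ) :* c :+ con 0ℚ := a :* (b :* c :+ con 0ℚ) :+ con 0ℚ) refl (f 0) (g 0) (h 0)
  ⊛-assoc f g h (suc n) = begin
    (f ⊛ g) 0 * h (suc n) + (tail (f ⊛ g) ⊛ h) n
      ≡⟨ cong (_+_ ((f ⊛ g) 0 * h (suc n))) (trans (⊛-+ˡ (λ k → f 0 * tail g k) (tail f ⊛ g) h n)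
           (cong₂ _+_ (⊛-*ˡ (f 0) (tail g) h n) (⊛-assoc (tail f) g h n))) ⟩
    (f ⊛ g) 0 * h (suc n) + (f 0 * (tail g ⊛ h) n + (tail f ⊛ (g ⊛ h)) n)
      ≡⟨ solve 5 (λ a b c d e → (a :* b :+ con 0ℚ) :* c :+ (a :* d :+ e) := a :* (b :* c :+ d) :+ e) refl
           (f 0) (g 0) (h (suc n)) ((tail g ⊛ h) n) ((tail f ⊛ (g ⊛ h)) n) ⟩
    f 0 * (g ⊛ h) (suc n) + (tail f ⊛ (g ⊛ h)) n ∎

  -- The recursion built into `⊛` peels off its left factor; commutativity needs this mirror image.
  ⊛-tailʳ : ∀ f g n → (f ⊛ g) (suc n) ≡ f (suc n) * g 0 + (f ⊛ tail g) n
  ⊛-tailʳ f g zero    = solve 4 (λ a b c d → a :* b :+ (c :* d :+ con 0ℚ) := c :* d :+ (a :* b :+ con 0ℚ)) refl (f 0) (g 1) (f 1) (g 0)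
  ⊛-tailʳ f g (suc n) = trans (cong (_+_ (f 0 * g (2 ℕ.+ n))) (⊛-tailʳ (tail f) g n))
    (solve 3 (λ a b c → a :+ (b :+ c) := b :+ (a :+ c)) refl
      (f 0 * g (2 ℕ.+ n)) (f (2 ℕ.+ n) * g 0) ((tail f ⊛ tail g) n))

  ⊛-comm : ∀ f g n → (f ⊛ g) n ≡ (g ⊛ f) n
  ⊛-comm f g zero    = cong (_+ 0ℚ) (*-comm (f 0) (g 0))
  ⊛-comm f g (suc n) = begin
    f 0 * g (suc n) + (tail f ⊛ g) n  ≡⟨ cong₂ _+_ (*-comm (f 0) (g (suc n))) (⊛-comm (tail f) g n) ⟩
    g (suc n) * f 0 + (g ⊛ tail f) n  ≡⟨ ⊛-tailʳ g f n ⟨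
    (g ⊛ f) (suc n)                   ∎

  ⊛-0 : ∀ f n → (f ⊛ λ _ → 0ℚ) n ≡ 0ℚ
  ⊛-0 f zero    = trans (+-identityʳ _) (zeroʳ (f 0))
  ⊛-0 f (suc n) = trans (cong₂ _+_ (zeroʳ (f 0)) (⊛-0 (tail f) n)) (+-identityˡ 0ℚ)

  ⊛-one : ∀ f n → (f ⊛ one) n ≡ f n
  ⊛-one f zero    = trans (+-identityʳ _) (*-identityʳ (f 0))
  ⊛-one f (suc n) = begin
    (f ⊛ one) (suc n)                   ≡⟨ ⊛-tailʳ f one n ⟩
    f (suc n) * 1ℚ + (f ⊛ λ _ → 0ℚ) n   ≡⟨ cong₂ _+_ (*-identityʳ (f (suc n))) (⊛-0 f n) ⟩
    f (suc n) + 0ℚ                      ≡⟨ +-identityʳ _ ⟩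
    f (suc n)                           ∎

  exp[_] : ℕ → Series
  exp[ a ] = egf λ i → fromℕ (a ^ i)

  1/k!*1/[n∸k]! : ∀ {n k} → k ℕ.≤ n → 1/ k ! * 1/ (n ∸ k) ! ≡ fromℕ (n C k) * 1/ n !
  1/k!*1/[n∸k]! {n} {k} k≤n = begin
    u * v                      ≡⟨ *-identityʳ (u * v) ⟨
    u * v * 1ℚ                 ≡⟨ cong (u * v *_) (n!*1/n! n) ⟨
    u * v * (fromℕ (n !) * w)  ≡⟨ cong (λ x → u * v * (x * w)) N≡ ⟩
    u * v * (c * (K * L) * w)  ≡⟨ solve 6 (λ u v w c K L → u :* v :* (c :* (K :* L) :* w)
                                    := c :* w :* ((K :* u) :* (L :* v))) refl u v w c K L ⟩
    c * w * ((K * u) * (L * v)) ≡⟨ cong₂ (λ x y → c * w * (x * y)) (n!*1/n! k) (n!*1/n! (n ∸ k)) ⟩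
    c * w * (1ℚ * 1ℚ)          ≡⟨ *-identityʳ (c * w) ⟩
    c * w                      ∎
    where
    u v w c K L : ℚ
    u = 1/ k !
    v = 1/ (n ∸ k) !
    w = 1/ n !
    c = fromℕ (n C k)
    K = fromℕ (k !)
    L = fromℕ ((n ∸ k) !)
    N≡ : fromℕ (n !) ≡ c * (K * L)
    N≡ = trans (cong fromℕ (sym (nCk*k!*[n∸k]! k≤n))) (trans (fromℕ-* (n C k) _) (cong (c *_) (fromℕ-* (k !) _)))

  exp⊛exp[a] : ∀ a n → (exp ⊛ exp[ a ]) n ≡ exp[ suc a ] n
  exp⊛exp[a] a n = begin
    (exp ⊛ exp[ a ]) n
      ≡⟨ sum-cong-≗ {suc n} term ⟩
    ∑[ k < suc n ] (fromℕ (g k) * 1/ n !)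
      ≡⟨ *-distribʳ-sum {suc n} (1/ n !) (fromℕ ∘ g) ⟨
    ∑[ k < suc n ] fromℕ (g k) * 1/ n !
      ≡⟨ cong (_* 1/ n !) (trans (sym (fromℕ-sum (suc n) g)) (cong fromℕ (sym ([1+a]^n a n)))) ⟩
    exp[ suc a ] n ∎
    where
    g : Fin (suc n) → ℕ
    g k = (n C toℕ k) ℕ.* a ^ (n ∸ toℕ k)
    term : ∀ k → 1/ toℕ k ! * exp[ a ] (n ∸ toℕ k) ≡ fromℕ (g k) * 1/ n !
    term k = begin
      1/ toℕ k ! * (x * 1/ (n ∸ toℕ k) !)
        ≡⟨ solve 3 (λ u x v → u :* (x :* v) := u :* v :* x) refl (1/ toℕ k !) x (1/ (n ∸ toℕ k) !) ⟩
      1/ toℕ k ! * 1/ (n ∸ toℕ k) ! * x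
        ≡⟨ cong (_* x) (1/k!*1/[n∸k]! {n} (toℕ≤pred[n] k)) ⟩
      fromℕ (n C toℕ k) * 1/ n ! * x
        ≡⟨ solve 3 (λ c w x → c :* w :* x := c :* x :* w) refl (fromℕ (n C toℕ k)) (1/ n !) x ⟩
      fromℕ (n C toℕ k) * x * 1/ n !
        ≡⟨ cong (_* 1/ n !) (fromℕ-* (n C toℕ k) _) ⟨
      fromℕ (g k) * 1/ n ! ∎
      where
      x : ℚ
      x = fromℕ (a ^ (n ∸ toℕ k))

  -- (eᶻ − 1)/z · Σ_{a<n} e^{az} = (e^{nz} − 1)/z, by telescoping.

  [exp-1]/z⊛powerSum : ∀ n m → ([exp-1]/z ⊛ egf (fromℕ ∘ powerSum n)) m ≡ exp[ n ] (suc m)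
  [exp-1]/z⊛powerSum zero m = begin
    ([exp-1]/z ⊛ egf (λ _ → fromℕ 0)) m  ≡⟨ ⊛-cong {f = [exp-1]/z} (λ _ → refl) (λ k → zeroˡ (1/ k !)) m ⟩
    ([exp-1]/z ⊛ λ _ → 0ℚ) m             ≡⟨ ⊛-0 [exp-1]/z m ⟩
    0ℚ                                   ≡⟨ zeroˡ (1/ suc m !) ⟨
    exp[ 0 ] (suc m)                     ∎
  [exp-1]/z⊛powerSum (suc n) m = begin
    ([exp-1]/z ⊛ egf (fromℕ ∘ powerSum (suc n))) m
      ≡⟨ ⊛-cong {f = [exp-1]/z} (λ _ → refl) split m ⟩
    ([exp-1]/z ⊛ λ k → egf (fromℕ ∘ powerSum n) k + exp[ n ] k) m
      ≡⟨ ⊛-+ʳ [exp-1]/z (egf (fromℕ ∘ powerSum n)) exp[ n ] m ⟩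
    ([exp-1]/z ⊛ egf (fromℕ ∘ powerSum n)) m + ([exp-1]/z ⊛ exp[ n ]) m
      -- `tail exp` is `[exp-1]/z` and `exp 0` is 1, so the resulting sum is by computation the
      -- coefficient of eᶻ · eⁿᶻ at `suc m`.
      ≡⟨ cong (_+ ([exp-1]/z ⊛ exp[ n ]) m) (trans ([exp-1]/z⊛powerSum n m) (sym (*-identityˡ _))) ⟩
    (exp ⊛ exp[ n ]) (suc m)
      ≡⟨ exp⊛exp[a] n (suc m) ⟩
    exp[ suc n ] (suc m) ∎
    where
    split : egf (fromℕ ∘ powerSum (suc n)) ≗ λ k → egf (fromℕ ∘ powerSum n) k + exp[ n ] k
    split k = trans (cong (λ x → fromℕ x * 1/ k !) (sum-last n (_^ k)))
      (trans (cong (_* 1/ k !) (fromℕ-+ (powerSum n k) (n ^ k)))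
        (*-distribʳ-+ (1/ k !) (fromℕ (powerSum n k)) (fromℕ (n ^ k))))

  -- `tail exp[ n ]` is (eⁿᶻ - 1)/z; multiplying the telescoped identity by z/(eᶻ - 1) isolates the
  -- generating function of the power sums.
  faulhaber : ∀ n m → (tail exp[ n ] ⊛ recip [exp-1]/z) m ≡ egf (fromℕ ∘ powerSum n) m
  faulhaber n m = begin
    (tail exp[ n ] ⊛ b) m         ≡⟨ ⊛-cong {g = b} (λ k → sym (trans (⊛-comm E [exp-1]/z k) ([exp-1]/z⊛powerSum n k))) (λ _ → refl) m ⟩
    ((E ⊛ [exp-1]/z) ⊛ b) m       ≡⟨ ⊛-assoc E [exp-1]/z b m ⟩
    (E ⊛ ([exp-1]/z ⊛ b)) m       ≡⟨ ⊛-cong {f = E} (λ _ → refl) (recip-inverse [exp-1]/z refl) m ⟩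
    (E ⊛ one) m                   ≡⟨ ⊛-one E m ⟩
    E m                           ∎
    where
    E b : Series
    E = egf (fromℕ ∘ powerSum n)
    b = recip [exp-1]/z

-- Localization at a prime

module Valuation where

  open PowerSum
  open GeneratingFunction
  open import Data.Nat as ℕ using (ℕ; zero; suc; _∸_; _!; _^_; z≤n; s≤s)
  import Data.Nat.Properties as ℕ
  import Data.Nat.Divisibility as ℕ
  import Data.Nat.DivMod as ℕ
  open import Data.Nat.Primality using (Prime; prime?; euclidsLemma; prime⇒nonZero; ¬prime[1])
  open import Data.Nat.Coprimality using (recompute)
  open import Data.Nat.Induction using (<-rec)
  open import Data.Nat.Combinatorics using (_C_)
  open import Data.Nat.Solver renaming (module +-*-Solver to ℕ-Solver)
  open import Data.Integer as ℤ using (ℤ; +_)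
  import Data.Integer.Properties as ℤ
  import Data.Integer.Divisibility.Signed as Signed
  open import Data.Rational using (ℚ; mkℚ; 0ℚ; 1ℚ; _+_; _*_; -_; _-_; _/_; ↥_; ↧_)
  open import Data.Rational.Properties hiding (_≟_)
  open import Data.Rational.Solver using (module +-*-Solver)
  open import Data.Fin using (Fin; zero; suc; toℕ)
  open import Data.Fin.Properties using (toℕ<n)
  open import Data.Product using (∃; _×_; _,_; proj₁; proj₂)
  open import Data.Sum using (inj₁; inj₂; [_,_]′)
  open import Function using (_∘_)
  open import Relation.Nullary using (¬_; contradiction; yes; no)
  open import Relation.Nullary.Decidable using (from-yes)
  open import Relation.Binary.PropositionalEquality hiding (J)
  open import Algebra.Bundles using (module CommutativeRing)
  open CommutativeRing +-*-commutativeRing using (semiring; zeroʳ)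
  open import Algebra.Properties.Semiring.Sum semiring
  open +-*-Solver using (solve; _:=_; _:+_; _:*_; _:-_; :-_; con)
  open ≡-Reasoning

  cancel-fromℕ : ∀ n .{{_ : ℕ.NonZero n}} {x y} → fromℕ n * x ≡ fromℕ n * y → x ≡ y
  cancel-fromℕ n {x} {y} eq = begin
    x                  ≡⟨ lem x ⟨
    u * (fromℕ n * x)  ≡⟨ cong (u *_) eq ⟩
    u * (fromℕ n * y)  ≡⟨ lem y ⟩
    y                  ∎
    where
    u : ℚ
    u = + 1 / n
    lem : ∀ w → u * (fromℕ n * w) ≡ w
    lem w = trans (solve 3 (λ u n w → u :* (n :* w) := n :* u :* w) refl u (fromℕ n) w)
      (trans (cong (_* w) (↥[1/n] n)) (*-identityˡ w))

  module Localization {p : ℕ} (pPrime : Prime p) where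

    private instance
      p≢0 : ℕ.NonZero p
      p≢0 = prime⇒nonZero pPrime

    infix 4 _∈𝔭^_

    -- x ∈𝔭^ e means x ∈ pᵉℤ₍ₚ₎.

    record _∈𝔭^_ (x : ℚ) (e : ℕ) : Set where
      constructor fraction
      field
        denom    : ℕ
        factor   : ℤ
        p∤denom  : ¬ p ℕ.∣ denom
        denom*x≡ : fromℕ denom * x ≡ fromℕ (p ^ e) * fromℤ factor

    p∤1 : ¬ p ℕ.∣ 1
    p∤1 p∣1 = contradiction (ℕ.∣1⇒≡1 p∣1) λ { refl → ¬prime[1] pPrime }

    p∤* : ∀ {c d} → ¬ p ℕ.∣ c → ¬ p ℕ.∣ d → ¬ p ℕ.∣ c ℕ.* d
    p∤* {c} {d} p∤c p∤d h = [ p∤c , p∤d ]′ (euclidsLemma c d pPrime h)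

    fromℤ-∈ : ∀ i → fromℤ i ∈𝔭^ 0
    fromℤ-∈ i = fraction 1 i p∤1 refl

    p^-∈ : ∀ e → fromℕ (p ^ e) ∈𝔭^ e
    p^-∈ e = fraction 1 (+ 1) p∤1 (*-comm 1ℚ (fromℕ (p ^ e)))

    0-∈ : ∀ e → 0ℚ ∈𝔭^ e
    0-∈ e = fraction 1 (+ 0) p∤1 (trans (zeroʳ 1ℚ) (sym (zeroʳ (fromℕ (p ^ e)))))

    +-∈ : ∀ {e x y} → x ∈𝔭^ e → y ∈𝔭^ e → x + y ∈𝔭^ e
    +-∈ {e} {x} {y} (fraction c m p∤c cx) (fraction d n p∤d dy) =
      fraction (c ℕ.* d) (+ d ℤ.* m ℤ.+ + c ℤ.* n) (p∤* p∤c p∤d) (begin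
        fromℕ (c ℕ.* d) * (x + y)
          ≡⟨ cong (_* (x + y)) (fromℕ-* c d) ⟩
        fromℕ c * fromℕ d * (x + y)
          ≡⟨ solve 4 (λ c d x y → c :* d :* (x :+ y) := d :* (c :* x) :+ c :* (d :* y)) refl (fromℕ c) (fromℕ d) x y ⟩
        fromℕ d * (fromℕ c * x) + fromℕ c * (fromℕ d * y)
          ≡⟨ cong₂ (λ u v → fromℕ d * u + fromℕ c * v) cx dy ⟩
        fromℕ d * (P * fromℤ m) + fromℕ c * (P * fromℤ n)
          ≡⟨ solve 5 (λ c d P m n → d :* (P :* m) :+ c :* (P :* n) := P :* (d :* m :+ c :* n)) refl
               (fromℕ c) (fromℕ d) P (fromℤ m) (fromℤ n) ⟩
        P * (fromℕ d * fromℤ m + fromℕ c * fromℤ n)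
          ≡⟨ cong (P *_) (trans (fromℤ-+ (+ d ℤ.* m) (+ c ℤ.* n)) (cong₂ _+_ (fromℤ-* (+ d) m) (fromℤ-* (+ c) n))) ⟨
        P * fromℤ (+ d ℤ.* m ℤ.+ + c ℤ.* n) ∎)
      where
      P : ℚ
      P = fromℕ (p ^ e)

    *-∈ : ∀ {e f x y} → x ∈𝔭^ e → y ∈𝔭^ f → x * y ∈𝔭^ (e ℕ.+ f)
    *-∈ {e} {f} {x} {y} (fraction c m p∤c cx) (fraction d n p∤d dy) = fraction (c ℕ.* d) (m ℤ.* n) (p∤* p∤c p∤d) (begin
      fromℕ (c ℕ.* d) * (x * y)
        ≡⟨ cong (_* (x * y)) (fromℕ-* c d) ⟩
      fromℕ c * fromℕ d * (x * y)
        ≡⟨ solve 4 (λ c d x y → c :* d :* (x :* y) := c :* x :* (d :* y)) refl (fromℕ c) (fromℕ d) x y ⟩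
      fromℕ c * x * (fromℕ d * y)
        ≡⟨ cong₂ _*_ cx dy ⟩
      P * fromℤ m * (R * fromℤ n)
        ≡⟨ solve 4 (λ P m R n → P :* m :* (R :* n) := P :* R :* (m :* n)) refl P (fromℤ m) R (fromℤ n) ⟩
      P * R * (fromℤ m * fromℤ n)
        ≡⟨ cong₂ _*_ (trans (cong fromℕ (ℕ.^-distribˡ-+-* p e f)) (fromℕ-* (p ^ e) (p ^ f))) (fromℤ-* m n) ⟨
      fromℕ (p ^ (e ℕ.+ f)) * fromℤ (m ℤ.* n) ∎)
      where
      P R : ℚ
      P = fromℕ (p ^ e)
      R = fromℕ (p ^ f)

    *ˡ-∈ : ∀ {e x y} → x ∈𝔭^ 0 → y ∈𝔭^ e → x * y ∈𝔭^ e
    *ˡ-∈ = *-∈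

    *ʳ-∈ : ∀ {e x y} → x ∈𝔭^ e → y ∈𝔭^ 0 → x * y ∈𝔭^ e
    *ʳ-∈ {e} {x} {y} hx hy = subst (_∈𝔭^ e) (*-comm y x) (*ˡ-∈ hy hx)

    -‿∈ : ∀ {e x y} → x ∈𝔭^ e → y ∈𝔭^ e → x - y ∈𝔭^ e
    -‿∈ {e} {x} {y} hx hy = subst (_∈𝔭^ e) (cong (_+_ x) (solve 1 (λ y → con (- 1ℚ) :* y := :- y) refl y))
      (+-∈ hx (*ˡ-∈ (fromℤ-∈ (ℤ.- + 1)) hy))

    sum-∈ : ∀ {e} n (g : Fin n → ℚ) → (∀ i → g i ∈𝔭^ e) → sum g ∈𝔭^ e
    sum-∈ {e} zero    g h = 0-∈ e
    sum-∈ (suc n) g h = +-∈ (h zero) (sum-∈ n (g ∘ suc) (h ∘ suc))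

    cancel-∈ : ∀ {e c x} → ¬ p ℕ.∣ c → fromℕ c * x ∈𝔭^ e → x ∈𝔭^ e
    cancel-∈ {e} {c} {x} p∤c (fraction d n p∤d eq) = fraction (d ℕ.* c) n (p∤* p∤d p∤c)
      (trans (cong (_* x) (fromℕ-* d c)) (trans (*-assoc (fromℕ d) (fromℕ c) x) eq))

    cancel-p-∈ : ∀ {e x} → fromℕ p * x ∈𝔭^ suc e → x ∈𝔭^ e
    cancel-p-∈ {e} {x} (fraction d n p∤d eq) = fraction d n p∤d (cancel-fromℕ p (begin
      fromℕ p * (fromℕ d * x)             ≡⟨ solve 3 (λ p d x → p :* (d :* x) := d :* (p :* x)) refl (fromℕ p) (fromℕ d) x ⟩
      fromℕ d * (fromℕ p * x)             ≡⟨ eq ⟩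
      fromℕ (p ℕ.* p ^ e) * fromℤ n       ≡⟨ cong (_* fromℤ n) (fromℕ-* p (p ^ e)) ⟩
      fromℕ p * fromℕ (p ^ e) * fromℤ n   ≡⟨ *-assoc (fromℕ p) (fromℕ (p ^ e)) (fromℤ n) ⟩
      fromℕ p * (fromℕ (p ^ e) * fromℤ n) ∎))

    p*-∈ : ∀ {e x} → x ∈𝔭^ e → fromℕ p * x ∈𝔭^ suc e
    p*-∈ {e} {x} = *-∈ {1} {e} {fromℕ p} {x} (subst (λ q → fromℕ q ∈𝔭^ 1) (ℕ.^-identityʳ p) (p^-∈ 1))

    private
      fromℤ-∈⇒∣ : ∀ i e → fromℤ i ∈𝔭^ e → p ^ e ℕ.∣ ℤ.∣ i ∣
      fromℤ-∈⇒∣ i e (fraction d n p∤d eq) = p^e∣c*s⇒p^e∣s {c = d} pPrime p∤d e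
        (subst (p ^ e ℕ.∣_) (sym abs-eq) (ℕ.m∣m*n ℤ.∣ n ∣))
        where
        abs-eq : d ℕ.* ℤ.∣ i ∣ ≡ p ^ e ℕ.* ℤ.∣ n ∣
        abs-eq = trans (sym (ℤ.abs-* (+ d) i)) (trans (cong ℤ.∣_∣ (fromℤ-injective {+ d ℤ.* i} {+ (p ^ e) ℤ.* n}
          (trans (fromℤ-* (+ d) i) (trans eq (sym (fromℤ-* (+ (p ^ e)) n)))))) (ℤ.abs-* (+ (p ^ e)) n))

    fromℕ-∈⇒∣ : ∀ {e s} → fromℕ s ∈𝔭^ e → p ^ e ℕ.∣ s
    fromℕ-∈⇒∣ {e} {s} = fromℤ-∈⇒∣ (+ s) e

    ∣⇒fromℕ-∈ : ∀ {e s} → p ^ e ℕ.∣ s → fromℕ s ∈𝔭^ e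
    ∣⇒fromℕ-∈ {e} (ℕ.divides t refl) = subst (_∈𝔭^ e) (sym (fromℕ-* t (p ^ e))) (*ˡ-∈ (fromℤ-∈ (+ t)) (p^-∈ e))

    ∈⇒∣num : ∀ {x} → x ∈𝔭^ 1 → p ∣num x
    ∈⇒∣num {x} hx = subst (ℕ._∣ ℤ.∣ ↥ x ∣) (ℕ.^-identityʳ p)
      (fromℤ-∈⇒∣ (↥ x) 1 (subst (_∈𝔭^ 1) (↧*q≡↥ x) (*ˡ-∈ (fromℤ-∈ (↧ x)) hx)))

    -- Lowest terms matter: `p` in the numerator is kept out of the denominator, which can then
    -- serve as `denom`.
    ∣num⇒∈ : ∀ {x} → p ∣num x → x ∈𝔭^ 1
    ∣num⇒∈ {x@(mkℚ n d-1 coprime)} p∣n = go (Signed.∣ᵤ⇒∣ p∣n)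
      where
      p∤d : ¬ p ℕ.∣ suc d-1
      p∤d p∣d = p∤1 (ℕ.∣-reflexive (recompute coprime (p∣n , p∣d)))
      go : + p Signed.∣ n → x ∈𝔭^ 1
      go (Signed.divides k eq) = fraction (suc d-1) k p∤d (begin
        fromℕ (suc d-1) * x           ≡⟨ ↧*q≡↥ x ⟩
        fromℤ n                       ≡⟨ cong fromℤ (trans eq (ℤ.*-comm k (+ p))) ⟩
        fromℤ (+ p ℤ.* k)             ≡⟨ fromℤ-* (+ p) k ⟩
        fromℕ p * fromℤ k             ≡⟨ cong (λ q → fromℕ q * fromℤ k) (ℕ.^-identityʳ p) ⟨
        fromℕ (p ^ 1) * fromℤ k       ∎)

  ∣-*-^ : ∀ {m n x} p e → m ℕ.≤ n → x ℕ.∣ e ℕ.* p ^ m → x ℕ.∣ e ℕ.* p ^ n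
  ∣-*-^ {m} {n} p e m≤n h = ℕ.∣-trans h (ℕ.*-monoʳ-∣ e (subst (λ k → p ^ m ℕ.∣ p ^ k) (ℕ.m+[n∸m]≡n m≤n)
    (subst (p ^ m ℕ.∣_) (sym (ℕ.^-distribˡ-+-* p m (n ∸ m))) (ℕ.m∣m*n _))))

  -- pʲ/(j+1) lies in pᵉℤ₍ₚ₎ for e ≤ j, where n = j + 1.

  n*p^e∣d*p^[n-1] : ∀ {p} → Prime p → ∀ n e → 2 ℕ.+ e ℕ.≤ p → e ℕ.< n →
                    ∃ λ d → ¬ p ℕ.∣ d × n ℕ.* p ^ e ℕ.∣ d ℕ.* p ^ (n ∸ 1)
  n*p^e∣d*p^[n-1] {p} pPrime = <-rec _ step
    where
    P : ℕ → Set
    P n = ∀ e → 2 ℕ.+ e ℕ.≤ p → e ℕ.< n → ∃ λ d → ¬ p ℕ.∣ d × n ℕ.* p ^ e ℕ.∣ d ℕ.* p ^ (n ∸ 1)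
    -- If n = tp, the induction hypothesis with exponent 0 gives t ∣ d·pᵗ⁻¹. Multiplying by pᵉ⁺¹
    -- produces the exponent t + e, and this bound (with `suc t` for t) keeps it at most n - 1.
    bound : ∀ e t → 2 ℕ.+ e ℕ.≤ p → suc t ℕ.+ e ℕ.≤ suc t ℕ.* p ∸ 1
    bound e t 2+e≤p = ℕ.m+n≤o⇒m≤o∸n (suc t ℕ.+ e) (ℕ.≤-trans (ℕ.≤-reflexive
      (ℕ-Solver.solve 2 (λ t e → (con′ 1 ⊕ t ⊕ e) ⊕ con′ 1 ⊜ (con′ 2 ⊕ e) ⊕ t ) refl t e))
      (ℕ.+-mono-≤ 2+e≤p (ℕ.m≤m*n t p)))
      where
      open ℕ-Solver renaming (con to con′; _:+_ to _⊕_; _:=_ to _⊜_)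
      instance _ = prime⇒nonZero pPrime
    step : ∀ n → (∀ {t} → t ℕ.< n → P t) → P n
    step n rec e 2+e≤p e<n with p ℕ.∣? n
    ... | no p∤n = n , p∤n , ∣-*-^ p n (ℕ.m+n≤o⇒m≤o∸n e (subst (ℕ._≤ n) (ℕ.+-comm 1 e) e<n)) ℕ.∣-refl
    ... | yes (ℕ.divides zero refl) = contradiction e<n λ ()
    ... | yes (ℕ.divides t@(suc t-1) refl) = go (rec (ℕ.m<m*n t p (ℕ.m+n≤o⇒m≤o 2 2+e≤p)) 0 (ℕ.m+n≤o⇒m≤o 2 2+e≤p) (s≤s z≤n))
      where
      go : (∃ λ d → ¬ p ℕ.∣ d × t ℕ.* 1 ℕ.∣ d ℕ.* p ^ t-1) → _
      go (d , p∤d , t∣) = d , p∤d , ∣-*-^ p d (bound e t-1 2+e≤p)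
        (subst₂ ℕ._∣_
          (ℕ-Solver.solve 3 (λ t p P → (t ⊗ con′ 1) ⊗ (p ⊗ P) ⊜ t ⊗ p ⊗ P) refl t p (p ^ e))
          (trans (ℕ-Solver.solve 4 (λ d X p P → d ⊗ X ⊗ (p ⊗ P) ⊜ d ⊗ (p ⊗ X ⊗ P)) refl d (p ^ t-1) p (p ^ e))
            (cong (d ℕ.*_) (sym (ℕ.^-distribˡ-+-* p t e))))
          (ℕ.*-monoˡ-∣ (p ^ suc e) t∣))
        where open ℕ-Solver renaming (con to con′; _:*_ to _⊗_; _:=_ to _⊜_)

  -- Faulhaber's formula modulo p and p²

  b : Series
  b = recip [exp-1]/z

  -- This is C(m, j) nʲ⁺¹/(j+1) Bₘ₋ⱼ, the j-th term of Faulhaber's formula, with `n * B m` at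
  -- `j = 0`.
  faulhaberTerm : ℕ → ℕ → ℕ → ℚ
  faulhaberTerm n m j = fromℕ (m !) * (exp[ n ] (suc j) * b (m ∸ j))

  faulhaber-split : ∀ n m → fromℕ (powerSum n m) ≡ fromℕ n * B m + ∑[ k < m ] faulhaberTerm n m (suc (toℕ k))
  faulhaber-split n m = begin
    fromℕ (powerSum n m)
      ≡⟨ solve 1 (λ s → s := s :* con 1ℚ) refl (fromℕ (powerSum n m)) ⟩
    fromℕ (powerSum n m) * 1ℚ
      ≡⟨ cong (fromℕ (powerSum n m) *_) (n!*1/n! m) ⟨
    fromℕ (powerSum n m) * (M * 1/ m !)
      ≡⟨ solve 3 (λ s m w → s :* (m :* w) := m :* (s :* w)) refl (fromℕ (powerSum n m)) M (1/ m !) ⟩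
    M * egf (fromℕ ∘ powerSum n) m
      ≡⟨ cong (M *_) (faulhaber n m) ⟨
    M * (exp[ n ] 1 * b m + ∑[ k < m ] (exp[ n ] (2 ℕ.+ toℕ k) * b (m ∸ suc (toℕ k))))
      ≡⟨ *-distribˡ-+ M (exp[ n ] 1 * b m) _ ⟩
    M * (exp[ n ] 1 * b m) + M * ∑[ k < m ] (exp[ n ] (2 ℕ.+ toℕ k) * b (m ∸ suc (toℕ k)))
      ≡⟨ cong₂ _+_ (trans (cong (λ x → M * (x * b m)) exp1)
           (solve 3 (λ m n b → m :* (n :* b) := n :* (m :* b)) refl M (fromℕ n) (b m)))
           (*-distribˡ-sum {m} M (λ k → exp[ n ] (2 ℕ.+ toℕ k) * b (m ∸ suc (toℕ k)))) ⟩
    fromℕ n * B m + ∑[ k < m ] faulhaberTerm n m (suc (toℕ k)) ∎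
    where
    M : ℚ
    M = fromℕ (m !)
    exp1 : exp[ n ] 1 ≡ fromℕ n
    exp1 = trans (*-identityʳ (fromℕ (n ^ 1))) (cong fromℕ (ℕ.^-identityʳ n))

  module _ {p : ℕ} (pPrime : Prime p) where

    open Localization pPrime

    private instance
      p≢0 : ℕ.NonZero p
      p≢0 = prime⇒nonZero pPrime

    -- The term is C(m, j) · pʲ/(j+1) · pBₘ₋ⱼ: one factor `p` is spent on making the Bernoulli
    -- number integral, and the valuation of pʲ/(j+1) supplies `e`.
    faulhaberTerm-∈ : ∀ {e j m} → 2 ℕ.+ e ℕ.≤ p → e ℕ.≤ j → j ℕ.≤ m →
                      fromℕ p * B (m ∸ j) ∈𝔭^ 0 → faulhaberTerm p m j ∈𝔭^ e
    faulhaberTerm-∈ {e} {j} {m} 2+e≤p e≤j j≤m pB∈ = go (n*p^e∣d*p^[n-1] pPrime (suc j) e 2+e≤p (s≤s e≤j))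
      where
      go : (∃ λ d → ¬ p ℕ.∣ d × suc j ℕ.* p ^ e ℕ.∣ d ℕ.* p ^ j) → faulhaberTerm p m j ∈𝔭^ e
      go (d , p∤d , ℕ.divides t eq) = cancel-∈ p∤d (subst (_∈𝔭^ e) (sym value)
        (*ʳ-∈ (*ʳ-∈ (p^-∈ e) (fromℤ-∈ (+ (t ℕ.* (m C j))))) pB∈))
        where
        D N Pj w bk J K L S T Pe P : ℚ
        D = fromℕ d
        N = fromℕ (m !)
        P = fromℕ p
        Pj = fromℕ (p ^ j)
        Pe = fromℕ (p ^ e)
        w = 1/ suc j !
        bk = b (m ∸ j)
        J = fromℕ (j !)
        L = fromℕ ((m ∸ j) !)
        K = fromℕ (m C j)
        S = fromℕ (suc j)
        T = fromℕ t
        N≡ : N ≡ K * (J * L)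
        N≡ = trans (cong fromℕ (sym (nCk*k!*[n∸k]! j≤m))) (trans (fromℕ-* (m C j) _) (cong (K *_) (fromℕ-* (j !) _)))
        DPj≡ : D * Pj ≡ T * (S * Pe)
        DPj≡ = trans (sym (fromℕ-* d (p ^ j))) (trans (cong fromℕ eq) (trans (fromℕ-* t _) (cong (T *_) (fromℕ-* (suc j) (p ^ e)))))
        SJw≡ : S * J * w ≡ 1ℚ
        SJw≡ = trans (cong (_* w) (sym (fromℕ-* (suc j) (j !)))) (n!*1/n! (suc j))
        value : D * (N * (fromℕ (p ^ suc j) * w * bk)) ≡ Pe * fromℕ (t ℕ.* (m C j)) * (P * (L * bk))
        value = begin
          D * (N * (fromℕ (p ^ suc j) * w * bk))
            ≡⟨ cong₂ (λ x y → D * (x * (y * w * bk))) N≡ (fromℕ-* p (p ^ j)) ⟩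
          D * (K * (J * L) * (P * Pj * w * bk))
            ≡⟨ solve 8 (λ D K J L P Pj w b → D :* (K :* (J :* L) :* (P :* Pj :* w :* b))
                 := D :* Pj :* (K :* J :* w :* (P :* (L :* b)))) refl D K J L P Pj w bk ⟩
          D * Pj * (K * J * w * (P * (L * bk)))
            ≡⟨ cong (_* (K * J * w * (P * (L * bk)))) DPj≡ ⟩
          T * (S * Pe) * (K * J * w * (P * (L * bk)))
            ≡⟨ solve 7 (λ T S Pe K J w x → T :* (S :* Pe) :* (K :* J :* w :* x)
                 := S :* J :* w :* (Pe :* (T :* K) :* x)) refl T S Pe K J w (P * (L * bk)) ⟩
          S * J * w * (Pe * (T * K) * (P * (L * bk)))
            ≡⟨ cong₂ (λ x y → x * (Pe * y * (P * (L * bk)))) SJw≡ (sym (fromℕ-* t (m C j))) ⟩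
          1ℚ * (Pe * fromℕ (t ℕ.* (m C j)) * (P * (L * bk)))
            ≡⟨ *-identityˡ _ ⟩
          Pe * fromℕ (t ℕ.* (m C j)) * (P * (L * bk)) ∎

    private
      x-[x-y]≡y : ∀ x y → x - (x - y) ≡ y
      x-[x-y]≡y = solve 2 (λ x y → x :- (x :- y) := y) refl

      x-y+y≡x : ∀ x y → x - y + y ≡ x
      x-y+y≡x = solve 2 (λ x y → x :- y :+ y := x) refl

      difference : ∀ {x y r} → x ≡ y + r → x - y ≡ r
      difference {_} {y} {r} refl = solve 2 (λ y r → y :+ r :- y := r) refl y r

      difference′ : ∀ {x y r} → x ≡ y + r → x - r ≡ y
      difference′ {_} {y} {r} refl = solve 2 (λ y r → y :+ r :- r := y) refl y r

    module _ (3≤p : 3 ℕ.≤ p) where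

      -- In the expansion of `powerSum p m` all terms after `p * B m` involve Bernoulli numbers of
      -- smaller index, so strong induction applies with `e = 0`.
      pB-∈ : ∀ m → fromℕ p * B m ∈𝔭^ 0
      pB-∈ = <-rec _ λ m rec → subst (_∈𝔭^ 0) (difference′ (faulhaber-split p m))
        (-‿∈ (fromℤ-∈ (+ powerSum p m)) (sum-∈ m _ λ k →
          faulhaberTerm-∈ (ℕ.≤-trans (ℕ.n≤1+n 2) 3≤p) z≤n (toℕ<n k) (rec (ℕ.∸-monoʳ-< (s≤s z≤n) (toℕ<n k)))))

      powerSum-pB-∈𝔭 : ∀ m → fromℕ (powerSum p m) - fromℕ p * B m ∈𝔭^ 1
      powerSum-pB-∈𝔭 m = subst (_∈𝔭^ 1) (sym (difference (faulhaber-split p m)))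
        (sum-∈ m _ λ k → faulhaberTerm-∈ 3≤p (s≤s z≤n) (toℕ<n k) (pB-∈ (m ∸ suc (toℕ k))))

      p∣powerSum⇒B-∈ : ∀ m → p ℕ.∣ powerSum p m → B m ∈𝔭^ 0
      p∣powerSum⇒B-∈ m p∣S = cancel-p-∈ (subst (_∈𝔭^ 1) (x-[x-y]≡y (fromℕ (powerSum p m)) (fromℕ p * B m))
        (-‿∈ (∣⇒fromℕ-∈ (subst (ℕ._∣ powerSum p m) (sym (ℕ.^-identityʳ p)) p∣S)) (powerSum-pB-∈𝔭 m)))

      B-∈𝔭⇒p∣powerSum : ∀ m → fromℕ p * B m ∈𝔭^ 1 → p ℕ.∣ powerSum p m
      B-∈𝔭⇒p∣powerSum m pB∈ = subst (ℕ._∣ powerSum p m) (ℕ.^-identityʳ p) (fromℕ-∈⇒∣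
        (subst (_∈𝔭^ 1) (x-y+y≡x (fromℕ (powerSum p m)) (fromℕ p * B m)) (+-∈ (powerSum-pB-∈𝔭 m) pB∈)))

      module _ (4≤p : 4 ℕ.≤ p) (m : ℕ) (B-∈ : B m ∈𝔭^ 0) where

        private
          -- At `j = 1` the general bound reaches only exponent 1. Here `B m` is itself integral, so
          -- all of p²(m+1)/2 survives, and 2 is a unit.
          halfTerm : faulhaberTerm p (suc m) 1 ∈𝔭^ 2
          halfTerm = cancel-∈ {c = 2} (ℕ.>⇒∤ 3≤p) (subst (_∈𝔭^ 2) (sym value)
            (*ʳ-∈ (*ʳ-∈ (p^-∈ 2) (fromℤ-∈ (+ suc m))) B-∈))
            where
            value : fromℕ 2 * faulhaberTerm p (suc m) 1 ≡ fromℕ (p ^ 2) * fromℕ (suc m) * B m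
            value = begin
              fromℕ 2 * (fromℕ (suc m !) * (fromℕ (p ^ 2) * 1/ 2 ! * b m))
                ≡⟨ cong (λ x → fromℕ 2 * (x * (fromℕ (p ^ 2) * 1/ 2 ! * b m))) (fromℕ-* (suc m) (m !)) ⟩
              fromℕ 2 * (fromℕ (suc m) * fromℕ (m !) * (fromℕ (p ^ 2) * 1/ 2 ! * b m))
                ≡⟨ solve 6 (λ t s f q w b → t :* (s :* f :* (q :* w :* b)) := t :* w :* (q :* s :* (f :* b))) refl
                     (fromℕ 2) (fromℕ (suc m)) (fromℕ (m !)) (fromℕ (p ^ 2)) (1/ 2 !) (b m) ⟩
              1ℚ * (fromℕ (p ^ 2) * fromℕ (suc m) * B m)
                ≡⟨ *-identityˡ _ ⟩
              fromℕ (p ^ 2) * fromℕ (suc m) * B m ∎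

        powerSum-pB-∈𝔭² : fromℕ (powerSum p (suc m)) - fromℕ p * B (suc m) ∈𝔭^ 2
        powerSum-pB-∈𝔭² = subst (_∈𝔭^ 2) (sym (difference (faulhaber-split p (suc m))))
          (+-∈ halfTerm (sum-∈ m _ λ k →
            -- These are the terms with `j ≥ 2`. The bound `4 ≤ p` excludes `p = 3`, where p²/3 at
            -- `j = 2` would lose a factor.
            faulhaberTerm-∈ 4≤p (s≤s (s≤s z≤n)) (s≤s (toℕ<n k)) (pB-∈ (m ∸ suc (toℕ k)))))

        B-∈𝔭⇒p²∣powerSum : B (suc m) ∈𝔭^ 1 → p ^ 2 ℕ.∣ powerSum p (suc m)
        B-∈𝔭⇒p²∣powerSum hB = fromℕ-∈⇒∣
          (subst (_∈𝔭^ 2) (x-y+y≡x (fromℕ (powerSum p (suc m))) (fromℕ p * B (suc m))) (+-∈ powerSum-pB-∈𝔭² (p*-∈ hB)))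

        p²∣powerSum⇒B-∈𝔭 : p ^ 2 ℕ.∣ powerSum p (suc m) → B (suc m) ∈𝔭^ 1
        p²∣powerSum⇒B-∈𝔭 p²∣S = cancel-p-∈ (subst (_∈𝔭^ 2) (x-[x-y]≡y (fromℕ (powerSum p (suc m))) (fromℕ p * B (suc m)))
          (-‿∈ (∣⇒fromℕ-∈ p²∣S) powerSum-pB-∈𝔭²))

  odd∤ : ∀ {m} → 2 ℕ.∣ m → ¬ 2 ℕ.∣ suc m
  odd∤ 2∣m 2∣1+m = contradiction (ℕ.∣m+n∣m⇒∣n (subst (2 ℕ.∣_) (ℕ.+-comm 1 _) 2∣1+m) 2∣m) (ℕ.>⇒∤ (ℕ.n<1+n 1))

  ¬odd⇒even-pred : ∀ n → ¬ 2 ℕ.∣ suc n → 2 ℕ.∣ n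
  ¬odd⇒even-pred zero          _ = 2 ℕ.∣0
  ¬odd⇒even-pred (suc zero)    h = contradiction ℕ.∣-refl h
  ¬odd⇒even-pred (suc (suc n)) h = ℕ.∣m∣n⇒∣m+n ℕ.∣-refl (¬odd⇒even-pred n λ 2∣ → h (ℕ.∣m∣n⇒∣m+n ℕ.∣-refl 2∣))

  even-< : ∀ {m n} → 2 ℕ.∣ m → 2 ℕ.∣ n → m ℕ.< n → 2 ℕ.+ m ℕ.≤ n
  even-< 2∣m 2∣n m<n with ℕ.m≤n⇒m<n∨m≡n m<n
  ... | inj₁ h    = h
  ... | inj₂ refl = contradiction 2∣n (odd∤ 2∣m)

  -- Exponents modulo p - 1: von Staudt-Clausen and Kummer

  module Residues {n : ℕ} (pPrime : Prime (suc n)) where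

    private
      p : ℕ
      p = suc n
      instance
        n≢0 : ℕ.NonZero n
        n≢0 = prime⇒nonZero-pred pPrime

    open Localization pPrime

    1/k!-∈ : ∀ {k} → k ℕ.≤ n → 1/ k ! ∈𝔭^ 0
    1/k!-∈ {k} k≤n = cancel-∈ (p∤k! pPrime k k≤n) (subst (_∈𝔭^ 0) (sym (n!*1/n! k)) (fromℤ-∈ (+ 1)))

    -- Coefficient r of the telescoped identity reads Σₖ E(r-k)/(k+1)! = pʳ⁺¹/(r+1)!. For `r < n`
    -- every factorial in it is prime to `p`, so strong induction puts `E r` in pℤ₍ₚ₎.
    p∣powerSum-small : ∀ r → r ℕ.< n → p ℕ.∣ powerSum p r
    p∣powerSum-small r r<n = subst (ℕ._∣ powerSum p r) (ℕ.^-identityʳ p) (fromℕ-∈⇒∣ (subst (_∈𝔭^ 1) S≡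
      (*ˡ-∈ (fromℤ-∈ (+ (r !))) (E-∈ r r<n))))
      where
      E : Series
      E = egf (fromℕ ∘ powerSum p)
      S≡ : fromℕ (r !) * E r ≡ fromℕ (powerSum p r)
      S≡ = trans (solve 3 (λ f s w → f :* (s :* w) := f :* w :* s) refl (fromℕ (r !)) (fromℕ (powerSum p r)) (1/ r !))
        (trans (cong (_* fromℕ (powerSum p r)) (n!*1/n! r)) (*-identityˡ _))
        where open +-*-Solver
      E-∈ : ∀ r → r ℕ.< n → E r ∈𝔭^ 1
      E-∈ = <-rec _ λ r rec r<n → subst (_∈𝔭^ 1) (isolate r)
        (-‿∈ (*ʳ-∈ (subst (_∈𝔭^ 1) (sym (fromℕ-* p (p ^ r))) (p*-∈ (fromℤ-∈ (+ (p ^ r))))) (1/k!-∈ r<n))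
          (sum-∈ r _ λ k → *ˡ-∈ (1/k!-∈ (ℕ.≤-trans (s≤s (toℕ<n k)) r<n))
            (rec (ℕ.∸-monoʳ-< (s≤s z≤n) (toℕ<n k)) (ℕ.≤-<-trans (ℕ.m∸n≤m r (suc (toℕ k))) r<n))))
        where
        rest : ℕ → ℚ
        rest r = ∑[ k < r ] (1/ (2 ℕ.+ toℕ k) ! * E (r ∸ suc (toℕ k)))
        isolate : ∀ r → exp[ p ] (suc r) - rest r ≡ E r
        isolate r = trans (cong (_- rest r) (sym ([exp-1]/z⊛powerSum p r)))
          (solve 2 (λ e t → con 1ℚ :* e :+ t :- t := e) refl (E r) (rest r))
          where open +-*-Solver

    p∣powerSum : ∀ m → ¬ n ℕ.∣ m → p ℕ.∣ powerSum p m
    p∣powerSum m n∤m = go (m ℕ.% n) (ℕ.m≡m%n+[m/n]*n m n) (ℕ.m%n<n m n)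
      where
      go : ∀ r → m ≡ r ℕ.+ (m ℕ./ n) ℕ.* n → r ℕ.< n → p ℕ.∣ powerSum p m
      -- Remainder 0 is excluded by hypothesis; a positive remainder is what the periodicity of
      -- powers requires.
      go zero    eq _   = contradiction (ℕ.divides (m ℕ./ n) eq) n∤m
      go (suc r) eq r<n = subst (λ x → p ℕ.∣ powerSum p x) (sym eq)
        (∣-≤[] (powerSum-periodic pPrime r (m ℕ./ n)) (p∣powerSum-small (suc r) r<n))

    -- Half of von Staudt-Clausen: here `p * B m` is congruent to the power sum, which is -1 modulo
    -- `p`.
    n∣m⇒pB∉ : 3 ℕ.≤ p → ∀ {m} → .{{ℕ.NonZero m}} → n ℕ.∣ m → ¬ fromℕ p * B m ∈𝔭^ 1
    n∣m⇒pB∉ 3≤p (ℕ.divides zero    refl) = λ _ → contradiction (ℕ.≢-nonZero⁻¹ 0) λ h → h refl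
    n∣m⇒pB∉ 3≤p (ℕ.divides (suc k) refl) pB∈ = p∤powerSum pPrime k (B-∈𝔭⇒p∣powerSum pPrime 3≤p (suc k ℕ.* n) pB∈)

    module Kummer (4≤n : 4 ℕ.≤ n) (2∣n : 2 ℕ.∣ n) where

      private
        4≤p : 4 ℕ.≤ p
        4≤p = ℕ.≤-trans 4≤n (ℕ.n≤1+n n)
        3≤p : 3 ℕ.≤ p
        3≤p = ℕ.≤-trans (ℕ.n≤1+n 3) 4≤p

        p²≡ : p ℕ.* p ≡ p ^ 2
        p²≡ = cong (p ℕ.*_) (sym (ℕ.*-identityʳ p))

        -- An odd index is never a multiple of the even `n`, so `p` divides the power sum and
        -- cancels from `p * B m`. This feeds the `j = 1` term of Faulhaber's formula.
        odd-integral : ∀ m → 2 ℕ.∣ suc m → B m ∈𝔭^ 0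
        odd-integral m 2∣1+m = p∣powerSum⇒B-∈ pPrime 3≤p m (p∣powerSum m λ n∣m → odd∤ (ℕ.∣-trans 2∣n n∣m) 2∣1+m)

      module _ (l k : ℕ) (2∣l : 2 ℕ.∣ 2 ℕ.+ l) (n∤l : ¬ n ℕ.∣ 2 ℕ.+ l) where

        private
          m : ℕ
          m = l ℕ.+ k ℕ.* n
          2∣m : 2 ℕ.∣ 2 ℕ.+ m
          2∣m = ℕ.∣m∣n⇒∣m+n 2∣l (ℕ.∣n⇒∣m*n k 2∣n)
          p∣S : p ℕ.∣ powerSum p (2 ℕ.+ l)
          p∣S = p∣powerSum (2 ℕ.+ l) n∤l

        -- Power sum and `p * B` agree modulo p², so p ∣ B means that p² divides the power sum, and
        -- that property is transported along the exponent.
        kummer : ¬ p ℕ.∣ 2 ℕ.+ l → B (2 ℕ.+ l) ∈𝔭^ 1 → B (2 ℕ.+ m) ∈𝔭^ 1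
        kummer p∤l Bl∈ = p²∣powerSum⇒B-∈𝔭 pPrime 3≤p 4≤p (suc m) (odd-integral (suc m) 2∣m)
          (subst (ℕ._∣ powerSum p (2 ℕ.+ m)) p²≡ (p²∣powerSum-periodic pPrime l k p∣S p∤l
            (subst (ℕ._∣ powerSum p (2 ℕ.+ l)) (sym p²≡)
              (B-∈𝔭⇒p²∣powerSum pPrime 3≤p 4≤p (suc l) (odd-integral (suc l) 2∣l) Bl∈))))

        kummer⁻ : ¬ p ℕ.∣ 2 ℕ.+ m → B (2 ℕ.+ m) ∈𝔭^ 1 → B (2 ℕ.+ l) ∈𝔭^ 1
        kummer⁻ p∤m Bm∈ = p²∣powerSum⇒B-∈𝔭 pPrime 3≤p 4≤p (suc l) (odd-integral (suc l) 2∣l)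
          (subst (ℕ._∣ powerSum p (2 ℕ.+ l)) p²≡ (p²∣powerSum-periodic⁻ pPrime l k p∣S p∤m
            (subst (ℕ._∣ powerSum p (2 ℕ.+ m)) (sym p²≡)
              (B-∈𝔭⇒p²∣powerSum pPrime 3≤p 4≤p (suc m) (odd-integral (suc m) 2∣m) Bm∈))))

  -- At the prime 3 the number p - 1 = 2 divides every even index, so 3Bₘ lies outside 3ℤ₍₃₎,
  -- whereas 0 lies inside.
  B≢0 : ∀ m → .{{ℕ.NonZero m}} → 2 ℕ.∣ m → B m ≢ 0ℚ
  B≢0 m 2∣m B≡0 = n∣m⇒pB∉ ℕ.≤-refl 2∣m (subst (_∈𝔭^ 1)
    (sym (trans (cong (fromℕ 3 *_) B≡0) (zeroʳ (fromℕ 3)))) (0-∈ 1))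
    where
    open Residues (from-yes (prime? 3))
    open Localization (from-yes (prime? 3))

  -- The witness is m mod q - 1. It is nonzero, since q - 1 ∣ m would make qBₘ a unit at q; parity
  -- then gives the bounds of an irregular pair, and `kummer⁻` brings divisibility down from `m`,
  -- which is where `¬ q ∣ m` enters.
  irregularPrime : ∀ q m → OddPrime q → 2 ℕ.∣ m → .{{ℕ.NonZero m}} → ¬ q ℕ.∣ m → q ∣num B m → IrregularPrime q
  irregularPrime zero    m (pPrime , odd) 2∣m q∤m q∣B = contradiction (2 ℕ.∣0) odd
  irregularPrime q@(suc n) m (pPrime , odd) 2∣m q∤m q∣B =
    (pPrime , odd) , m ℕ.% n , (pPrime , odd) , 2∣r , proj₁ bounds , proj₂ bounds , ∈⇒∣num (B-∈ (m ℕ.% n) refl)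
    where
    open Residues pPrime
    open Localization pPrime
    instance
      n≢0 : ℕ.NonZero n
      n≢0 = prime⇒nonZero-pred pPrime
    2∣n : 2 ℕ.∣ n
    2∣n = ¬odd⇒even-pred n odd
    2≤n : 2 ℕ.≤ n
    2≤n = ℕ.∣⇒≤ 2∣n
    r : ℕ
    r = m ℕ.% n
    r<n : r ℕ.< n
    r<n = ℕ.m%n<n m n
    2∣r : 2 ℕ.∣ r
    2∣r = ℕ.%-presˡ-∣ 2∣m 2∣n
    n∤m : ¬ n ℕ.∣ m
    n∤m n∣m = n∣m⇒pB∉ (s≤s 2≤n) n∣m (*ˡ-∈ (fromℤ-∈ (+ q)) (∣num⇒∈ q∣B))
    instance
      r≢0 : ℕ.NonZero r
      r≢0 = ℕ.≢-nonZero λ r≡0 → n∤m (ℕ.m%n≡0⇒n∣m m n r≡0)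
    bounds : 2 ℕ.≤ r × r ℕ.≤ q ∸ 3
    bounds = ℕ.∣⇒≤ 2∣r , ℕ.m+n≤o⇒m≤o∸n r (subst (ℕ._≤ n) (ℕ.+-comm 2 r) (even-< 2∣r 2∣n r<n))
    -- An even residue strictly between 0 and the even `n` forces `n ≥ 4`, that is `q ≥ 5`, as
    -- Kummer's congruence requires here.
    4≤n : 4 ℕ.≤ n
    4≤n = ℕ.≤-trans (ℕ.+-monoʳ-≤ 2 (proj₁ bounds)) (even-< 2∣r 2∣n r<n)
    B-∈ : ∀ l → l ≡ r → B l ∈𝔭^ 1
    B-∈ zero          eq   = contradiction (sym eq) (ℕ.≢-nonZero⁻¹ r)
    B-∈ (suc zero)    eq   = contradiction (proj₁ bounds) λ h → ℕ.<⇒≱ (ℕ.≤-reflexive (cong suc (sym eq))) h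
    B-∈ (suc (suc l)) eq   = Kummer.kummer⁻ 4≤n 2∣n l (m ℕ./ n) (subst (2 ℕ.∣_) (sym eq) 2∣r)
      (λ n∣l → ℕ.<⇒≱ r<n (ℕ.∣⇒≤ (subst (n ℕ.∣_) eq n∣l)))
      (subst (λ x → ¬ q ℕ.∣ x) m≡ q∤m) (subst (λ x → B x ∈𝔭^ 1) m≡ (∣num⇒∈ q∣B))
      where
      m≡ : m ≡ 2 ℕ.+ (l ℕ.+ (m ℕ./ n) ℕ.* n)
      m≡ = trans (ℕ.m≡m%n+[m/n]*n m n) (cong (ℕ._+ (m ℕ./ n) ℕ.* n) (sym eq))

-- When Q(m) = p

module Numerator where

  open GeneratingFunction
  open Valuation using (cancel-fromℕ)
  open import Data.Nat as ℕ using (ℕ; zero; suc; _*_; _∸_; _≤_; z≤n; s≤s)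
  open import Data.Nat.Properties
  open import Data.Nat.Divisibility as ℕ using (_∣_; divides)
  open import Data.Nat.Primality using (Prime; euclidsLemma; prime⇒nonZero; prime⇒irreducible; ¬prime[1])
  open import Data.Nat.Primality.Factorisation using (PrimeFactorisation; factorise)
  open import Data.Nat.Coprimality using (Coprime; recompute)
  open import Data.Nat.ListAction using (product)
  open import Data.List using ([]; _∷_)
  open import Data.List.Relation.Unary.All using (_∷_)
  open import Data.Integer as ℤ using (+_; +0; +[1+_]; -[1+_])
  import Data.Integer.Properties as ℤ
  import Data.Integer.Divisibility.Signed as Signed
  open import Data.Integer.Solver renaming (module +-*-Solver to ℤ-Solver)
  open import Data.Rational as ℚ using (ℚ; mkℚ; 0ℚ; ↧_; ↧ₙ_; *≡*)
  import Data.Rational.Properties as ℚ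
  open import Data.Rational.Solver renaming (module +-*-Solver to ℚ-Solver)
  open import Data.Product using (∃; _×_; _,_)
  open import Data.Sum using ([_,_]′)
  open import Function using (_∘_)
  open import Relation.Nullary using (¬_; contradiction)
  open import Relation.Binary.PropositionalEquality
  open ≡-Reasoning

  fromℕ≢0 : ∀ n .{{_ : ℕ.NonZero n}} → fromℕ n ≢ 0ℚ
  fromℕ≢0 n eq = ℕ.≢-nonZero⁻¹ n (ℤ.+-injective (fromℤ-injective {+ n} {+ 0} eq))

  ÷₀-* : ∀ x {y} → y ≢ 0ℚ → (x ÷₀ y) ℚ.* y ≡ x
  ÷₀-* x {mkℚ +0 _ _}             y≢0 = contradiction (ℚ.↥p≡0⇒p≡0 _ refl) y≢0
  ÷₀-* x {y@(mkℚ +[1+ _ ] _ _)} y≢0 = trans (ℚ.*-assoc x (ℚ.1/ y) y) (trans (cong (x ℚ.*_) (ℚ.*-inverseˡ y)) (ℚ.*-identityʳ x))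
  ÷₀-* x {y@(mkℚ -[1+ _ ] _ _)} y≢0 = trans (ℚ.*-assoc x (ℚ.1/ y) y) (trans (cong (x ℚ.*_) (ℚ.*-inverseˡ y)) (ℚ.*-identityʳ x))

  *-÷₀ : ∀ x {y} → y ≢ 0ℚ → (x ℚ.* y) ÷₀ y ≡ x
  *-÷₀ x {mkℚ +0 _ _}             y≢0 = contradiction (ℚ.↥p≡0⇒p≡0 _ refl) y≢0
  *-÷₀ x {y@(mkℚ +[1+ _ ] _ _)} y≢0 = trans (ℚ.*-assoc x y (ℚ.1/ y)) (trans (cong (x ℚ.*_) (ℚ.*-inverseʳ y)) (ℚ.*-identityʳ x))
  *-÷₀ x {y@(mkℚ -[1+ _ ] _ _)} y≢0 = trans (ℚ.*-assoc x y (ℚ.1/ y)) (trans (cong (x ℚ.*_) (ℚ.*-inverseʳ y)) (ℚ.*-identityʳ x))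

  coprime-num-denom : ∀ x → Coprime ℤ.∣ num x ∣ (↧ₙ x)
  coprime-num-denom (mkℚ _ _ coprime) = recompute coprime

  prime-divisor : ∀ n .{{_ : ℕ.NonZero n}} → n ≢ 1 → ∃ λ q → Prime q × q ∣ n
  prime-divisor n n≢1 = go (factorise n)
    where
    go : PrimeFactorisation n → ∃ λ q → Prime q × q ∣ n
    go record { factors = []    ; isFactorisation = eq } = contradiction eq n≢1
    go record { factors = q ∷ qs ; isFactorisation = eq ; factorsPrime = qPrime ∷ _ } =
      q , qPrime , divides (product qs) (trans eq (*-comm q (product qs)))

  no-prime⇒coprime : ∀ m n → .{{ℕ.NonZero m}} → (∀ q → Prime q → q ∣ m → ¬ q ∣ n) → Coprime m n
  no-prime⇒coprime m n h {zero}  (i∣m , i∣n) = contradiction (ℕ.0∣⇒≡0 i∣m) (ℕ.≢-nonZero⁻¹ m)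
  no-prime⇒coprime m n h {suc zero} _ = refl
  no-prime⇒coprime m n h {i@(suc (suc _))} (i∣m , i∣n) with prime-divisor i (λ ())
  ... | q , qPrime , q∣i = contradiction (ℕ.∣-trans q∣i i∣n) (h q qPrime (ℕ.∣-trans q∣i i∣m))

  num-unique : ∀ x n d → .{{_ : ℕ.NonZero d}} → Coprime ℤ.∣ n ∣ d → num x ℤ.* + d ≡ n ℤ.* ↧ x → num x ≡ n
  num-unique x@record{} n (suc d-1) coprime eq = cong num (ℚ.≃⇒≡ {x} {mkℚ n d-1 coprime} (*≡* eq))

  B/m : ℕ → ℚ
  B/m m = B m ÷₀ fromℕ m

  B/m[m-1] : ℕ → ℚ
  B/m[m-1] m = B m ÷₀ fromℕ (m * (m ∸ 1))

  module _ (m : ℕ) (2≤m : 2 ≤ m) where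

    private
      instance
        m≢0 : ℕ.NonZero m
        m≢0 = ℕ.>-nonZero (≤-trans (s≤s z≤n) 2≤m)
        m-1≢0 : ℕ.NonZero (m ∸ 1)
        m-1≢0 = ℕ.>-nonZero (m<n⇒0<n∸m 2≤m)

    B/m*m : B/m m ℚ.* fromℕ m ≡ B m
    B/m*m = ÷₀-* (B m) (fromℕ≢0 m)

    B/m[m-1]*[m-1] : B/m[m-1] m ℚ.* fromℕ (m ∸ 1) ≡ B/m m
    B/m[m-1]*[m-1] = cancel-fromℕ m (begin
      fromℕ m ℚ.* (s ℚ.* fromℕ (m ∸ 1))  ≡⟨ solve 3 (λ m s n → m :* (s :* n) := s :* (m :* n)) refl (fromℕ m) s (fromℕ (m ∸ 1)) ⟩
      s ℚ.* (fromℕ m ℚ.* fromℕ (m ∸ 1))  ≡⟨ cong (s ℚ.*_) (fromℕ-* m (m ∸ 1)) ⟨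
      s ℚ.* fromℕ (m * (m ∸ 1))          ≡⟨ ÷₀-* (B m) (fromℕ≢0 (m * (m ∸ 1)) {{m*n≢0 m (m ∸ 1)}}) ⟩
      B m                                ≡⟨ B/m*m ⟨
      B/m m ℚ.* fromℕ m                  ≡⟨ ℚ.*-comm (B/m m) (fromℕ m) ⟩
      fromℕ m ℚ.* B/m m                  ∎)
      where
      open ℚ-Solver
      s : ℚ
      s = B/m[m-1] m

    num-B/m[m-1] : num (B/m[m-1] m) ℤ.* + (↧ₙ (B/m m) * (m ∸ 1)) ≡ num (B/m m) ℤ.* ↧ (B/m[m-1] m)
    num-B/m[m-1] = fromℤ-injective (begin
      fromℤ (num s ℤ.* + (↧ₙ r * (m ∸ 1)))                      ≡⟨ fromℤ-* (num s) (+ (↧ₙ r * (m ∸ 1))) ⟩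
      fromℤ (num s) ℚ.* fromℕ (↧ₙ r * (m ∸ 1))                  ≡⟨ cong₂ ℚ._*_ (sym (↧*q≡↥ s)) (fromℕ-* (↧ₙ r) (m ∸ 1)) ⟩
      fromℤ (↧ s) ℚ.* s ℚ.* (fromℤ (↧ r) ℚ.* fromℕ (m ∸ 1))     ≡⟨ solve 4 (λ D s E n → D :* s :* (E :* n) := E :* (s :* n) :* D) refl (fromℤ (↧ s)) s (fromℤ (↧ r)) (fromℕ (m ∸ 1)) ⟩
      fromℤ (↧ r) ℚ.* (s ℚ.* fromℕ (m ∸ 1)) ℚ.* fromℤ (↧ s)     ≡⟨ cong (λ x → fromℤ (↧ r) ℚ.* x ℚ.* fromℤ (↧ s)) B/m[m-1]*[m-1] ⟩
      fromℤ (↧ r) ℚ.* r ℚ.* fromℤ (↧ s)                         ≡⟨ cong (ℚ._* fromℤ (↧ s)) (↧*q≡↥ r) ⟩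
      fromℤ (num r) ℚ.* fromℤ (↧ s)                             ≡⟨ fromℤ-* (num r) (↧ s) ⟨
      fromℤ (num r ℤ.* ↧ s)                                     ∎)
      where
      open ℚ-Solver
      r s : ℚ
      r = B/m m
      s = B/m[m-1] m

    module _ {p : ℕ} .{{_ : ℕ.NonZero p}} (Q≡p : Q m ≡ fromℕ p) where

      private
        num-s≢0 : num (B/m[m-1] m) ≢ + 0
        -- A zero numerator would trigger the junk value of `÷₀` and make `Q m` zero, but `p` is
        -- nonzero.
        num-s≢0 eq = fromℕ≢0 p (trans (sym Q≡p) (cong (λ i → fromℤ (num (B/m m)) ÷₀ fromℤ i) eq))

      Q≡p⇒num : num (B/m m) ≡ + p ℤ.* num (B/m[m-1] m)
      Q≡p⇒num = fromℤ-injective (begin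
        fromℤ (num (B/m m))                      ≡⟨ ÷₀-* (fromℤ (num (B/m m))) (num-s≢0 ∘ fromℤ-injective {num (B/m[m-1] m)} {+ 0}) ⟨
        Q m ℚ.* fromℤ (num (B/m[m-1] m))         ≡⟨ cong (ℚ._* fromℤ (num (B/m[m-1] m))) Q≡p ⟩
        fromℕ p ℚ.* fromℤ (num (B/m[m-1] m))     ≡⟨ fromℤ-* (+ p) (num (B/m[m-1] m)) ⟨
        fromℤ (+ p ℤ.* num (B/m[m-1] m))         ∎)

      Q≡p⇒denom : ↧ₙ (B/m m) * (m ∸ 1) ≡ ↧ₙ (B/m[m-1] m) * p
      Q≡p⇒denom = ℤ.+-injective (ℤ.*-cancelˡ-≡ (num s) _ _ {{ℤ.≢-nonZero num-s≢0}} (begin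
        num s ℤ.* + (↧ₙ (B/m m) * (m ∸ 1))  ≡⟨ num-B/m[m-1] ⟩
        num (B/m m) ℤ.* ↧ s                 ≡⟨ cong (ℤ._* ↧ s) Q≡p⇒num ⟩
        + p ℤ.* num s ℤ.* ↧ s               ≡⟨ solve 3 (λ p n d → p :* n :* d := n :* (d :* p)) refl (+ p) (num s) (↧ s) ⟩
        num s ℤ.* (↧ s ℤ.* + p)             ≡⟨ cong (num s ℤ.*_) (ℤ.pos-* (↧ₙ s) p) ⟨
        num s ℤ.* + (↧ₙ s * p)              ∎))
        where
        open ℤ-Solver
        s : ℚ
        s = B/m[m-1] m

      Q≡p⇒∣num : p ∣num B/m m
      Q≡p⇒∣num = subst (p ∣_) (sym (trans (cong ℤ.∣_∣ Q≡p⇒num) (ℤ.abs-* (+ p) (num (B/m[m-1] m))))) (ℕ.m∣m*n _)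

    -- With Bₘ/m = N/D and s = Bₘ/(m(m-1)), Q(m) = p gives D(m - 1) = p·denom(s); since p ∣ N,
    -- lowest terms keep p out of D.
    Q≡p⇒p∣m-1 : ∀ {p} → Prime p → Q m ≡ fromℕ p → p ∣ m ∸ 1
    Q≡p⇒p∣m-1 {p} pPrime Q≡p = [ (λ p∣D → contradiction
        (coprime-num-denom (B/m m) (Q≡p⇒∣num Q≡p , p∣D)) λ { refl → ¬prime[1] pPrime }) , (λ h → h) ]′
      (euclidsLemma (↧ₙ (B/m m)) (m ∸ 1) pPrime (subst (p ∣_) (sym (Q≡p⇒denom Q≡p)) (ℕ.n∣m*n (↧ₙ (B/m[m-1] m)))))
      where instance _ = prime⇒nonZero pPrime

    -- Cancelling p from D(m - 1) = p·denom(s) leaves denom(s) = Dc. A prime q dividing both c and N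
    -- = p·num(s) would be p itself, which does not divide c, or a common factor of num(s) and
    -- denom(s).
    Q≡p⇒coprime : ∀ {p c q} → Prime p → m ∸ 1 ≡ c * p → ¬ p ∣ c → Q m ≡ fromℕ p →
                  Prime q → q ∣ c → ¬ q ∣num B/m m
    Q≡p⇒coprime {p} {c} {q} pPrime m-1≡cp p∤c Q≡p qPrime q∣c q∣num-r =
      [ (λ q∣p → [ (λ { refl → ¬prime[1] qPrime }) , (λ { refl → p∤c q∣c }) ]′ (prime⇒irreducible pPrime q∣p))
      , (λ q∣num-s → contradiction (coprime-num-denom s (q∣num-s , q∣denom)) λ { refl → ¬prime[1] qPrime })
      ]′ (euclidsLemma p ℤ.∣ num s ∣ qPrime
           (subst (q ∣_) (trans (cong ℤ.∣_∣ (Q≡p⇒num Q≡p)) (ℤ.abs-* (+ p) (num s))) q∣num-r))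
      where
      instance _ = prime⇒nonZero pPrime
      s : ℚ
      s = B/m[m-1] m
      q∣denom : q ∣ ↧ₙ s
      q∣denom = subst (q ∣_) (*-cancelʳ-≡ _ _ p (trans (*-assoc (↧ₙ (B/m m)) c p)
        (trans (cong (↧ₙ (B/m m) *_) (sym m-1≡cp)) (Q≡p⇒denom Q≡p)))) (ℕ.∣n⇒∣m*n (↧ₙ (B/m m)) q∣c)

    -- Writing N = Mp, the factor p cancels and s = M/(Dc). The hypotheses make this fraction
    -- reduced, so its numerator is M and Q(m) = pM/M; `B m ≢ 0ℚ` keeps that division off the junk
    -- value.
    coprime⇒Q≡p : ∀ {p c} .{{_ : ℕ.NonZero p}} .{{_ : ℕ.NonZero c}} → B m ≢ 0ℚ → m ∸ 1 ≡ c * p → p ∣num B/m m →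
                  (∀ q → Prime q → q ∣ c → ¬ q ∣num B/m m) → Q m ≡ fromℕ p
    coprime⇒Q≡p {p} {c} B≢0 m-1≡cp p∣num h = go (Signed.∣ᵤ⇒∣ p∣num)
      where
      open ℤ-Solver
      r s : ℚ
      r = B/m m
      s = B/m[m-1] m
      go : + p Signed.∣ num r → Q m ≡ fromℕ p
      go (Signed.divides M num-r≡) = begin
        fromℤ (num r) ÷₀ fromℤ (num s)         ≡⟨ cong₂ (λ i j → fromℤ i ÷₀ fromℤ j) (trans num-r≡ (ℤ.*-comm M (+ p))) num-s≡M ⟩
        fromℤ (+ p ℤ.* M) ÷₀ fromℤ M           ≡⟨ cong (_÷₀ fromℤ M) (fromℤ-* (+ p) M) ⟩
        (fromℕ p ℚ.* fromℤ M) ÷₀ fromℤ M       ≡⟨ *-÷₀ (fromℕ p) (M≢0 ∘ fromℤ-injective {M} {+ 0}) ⟩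
        fromℕ p                                ∎
        where
        M≢0 : M ≢ + 0
        M≢0 M≡0 = B≢0 (trans (sym B/m*m) (trans (cong (ℚ._* fromℕ m) (ℚ.↥p≡0⇒p≡0 r (trans num-r≡ (cong (ℤ._* + p) M≡0))))
          (ℚ.*-zeroˡ (fromℕ m))))
        instance
          M≢0′ : ℕ.NonZero ℤ.∣ M ∣
          M≢0′ = ℕ.≢-nonZero (M≢0 ∘ ℤ.∣i∣≡0⇒i≡0)
          Dc≢0 : ℕ.NonZero (↧ₙ r * c)
          Dc≢0 = m*n≢0 (↧ₙ r) c
        q∣r : ∀ {q} → q ∣ ℤ.∣ M ∣ → q ∣num r
        q∣r q∣M = subst (_ ∣_) (sym (trans (cong ℤ.∣_∣ num-r≡) (ℤ.abs-* M (+ p)))) (ℕ.∣m⇒∣m*n p q∣M)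
        coprime : Coprime ℤ.∣ M ∣ (↧ₙ r * c)
        coprime = no-prime⇒coprime ℤ.∣ M ∣ (↧ₙ r * c) λ q qPrime q∣M q∣Dc →
          [ (λ q∣D → contradiction (coprime-num-denom r (q∣r q∣M , q∣D)) λ { refl → ¬prime[1] qPrime })
          , (λ q∣c → h q qPrime q∣c (q∣r q∣M)) ]′ (euclidsLemma (↧ₙ r) c qPrime q∣Dc)
        num-s≡M : num s ≡ M
        num-s≡M = num-unique s M (↧ₙ r * c) coprime (ℤ.*-cancelʳ-≡ _ _ (+ p) (begin
          num s ℤ.* + (↧ₙ r * c) ℤ.* + p   ≡⟨ ℤ.*-assoc (num s) (+ (↧ₙ r * c)) (+ p) ⟩
          num s ℤ.* (+ (↧ₙ r * c) ℤ.* + p) ≡⟨ cong (num s ℤ.*_) (trans (sym (ℤ.pos-* (↧ₙ r * c) p))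
                                                 (cong +_ (trans (*-assoc (↧ₙ r) c p) (cong (↧ₙ r *_) (sym m-1≡cp))))) ⟩
          num s ℤ.* + (↧ₙ r * (m ∸ 1))     ≡⟨ num-B/m[m-1] ⟩
          num r ℤ.* ↧ s                    ≡⟨ cong (ℤ._* ↧ s) num-r≡ ⟩
          M ℤ.* + p ℤ.* ↧ s                ≡⟨ solve 3 (λ M p d → M :* p :* d := M :* d :* p) refl M (+ p) (↧ s) ⟩
          M ℤ.* ↧ s ℤ.* + p                ∎))

-- The least index X

module LeastIndex where

  open Valuation
  open Numerator
  open import Data.Nat as ℕ using (ℕ; suc; _+_; _*_; _∸_; _≤_; _<_; z≤n; s≤s)
  open import Data.Nat.Properties
  open import Data.Nat.Divisibility as ℕ using (_∣_)
  open import Data.Nat.Primality using (Prime; ¬prime[1])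
  open import Data.Nat.Solver renaming (module +-*-Solver to ℕ-Solver)
  open import Data.Integer using (+_)
  import Data.Rational.Properties as ℚ
  open import Data.Product using (_,_; proj₁; proj₂)
  open import Relation.Nullary using (¬_; contradiction)
  open import Relation.Binary.PropositionalEquality

  module _ {n l : ℕ} (irregular : IrregularPair (suc n) (2 + l)) where

    private
      p X : ℕ
      p = suc n
      X = suc l * p + 1

      oddPrime : OddPrime p
      oddPrime = proj₁ irregular
      pPrime : Prime p
      pPrime = proj₁ oddPrime
      2∣l : 2 ∣ 2 + l
      2∣l = proj₁ (proj₂ irregular)
      l≤p-3 : 2 + l ≤ p ∸ 3
      l≤p-3 = proj₁ (proj₂ (proj₂ (proj₂ irregular)))
      p∣B : p ∣num B (2 + l)
      p∣B = proj₂ (proj₂ (proj₂ (proj₂ irregular)))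
      2∣n : 2 ∣ n
      2∣n = ¬odd⇒even-pred n (proj₂ oddPrime)

      3≤p : 3 ≤ p
      3≤p = ≰⇒> λ p≤2 → contradiction (subst (2 + l ≤_) (m≤n⇒m∸n≡0 (m≤n⇒m≤1+n p≤2)) l≤p-3) λ ()
      4+l≤n : 4 + l ≤ n
      4+l≤n = ℕ.s≤s⁻¹ (subst (_≤ p) (+-comm (2 + l) 3) (m≤o∸n⇒m+n≤o (2 + l) 3≤p l≤p-3))
      4≤n : 4 ≤ n
      4≤n = m+n≤o⇒m≤o 4 4+l≤n
      l<n : 2 + l < n
      l<n = ≤-trans (n≤1+n (3 + l)) 4+l≤n

      -- Exhibits X as the member of the progression with `k = suc l`; the `l` of this module is two
      -- below the index of the irregular pair.
      X≡ : X ≡ 2 + (l + suc l * n)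
      X≡ = ℕ-Solver.solve 2 (λ l n → (con 1 :+ l) :* (con 1 :+ n) :+ con 1 := con 2 :+ (l :+ (con 1 :+ l) :* n)) refl l n
        where open ℕ-Solver
      X-1≡ : X ∸ 1 ≡ suc l * p
      X-1≡ = m+n∸n≡m (suc l * p) 1
      2≤X : 2 ≤ X
      2≤X = subst (2 ≤_) (sym X≡) (m≤m+n 2 _)
      2∣X : 2 ∣ X
      2∣X = subst (2 ∣_) (sym X≡) (ℕ.∣m∣n⇒∣m+n 2∣l (ℕ.∣n⇒∣m*n (suc l) 2∣n))
      instance
        X≢0 : ℕ.NonZero X
        X≢0 = ℕ.>-nonZero (≤-trans (s≤s z≤n) 2≤X)

      ∤X : ∀ {q} → Prime q → q ∣ suc l * p → ¬ q ∣ X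
      ∤X qPrime q∣ q∣X = contradiction (ℕ.∣1⇒≡1 (ℕ.∣m+n∣m⇒∣n q∣X q∣)) λ { refl → ¬prime[1] qPrime }

      B-from-num : ∀ {q} → Prime q → q ∣num B/m X → q ∣num B X
      B-from-num qPrime q∣ = ∈⇒∣num (subst (_∈𝔭^ 1) (B/m*m X 2≤X) (*ʳ-∈ (∣num⇒∈ {B/m X} q∣) (fromℤ-∈ (+ X))))
        where open Localization qPrime

      -- X is congruent to `2 + l` modulo `n` and to 1 modulo `p`: the first lets `kummer` reach
      -- `B X`, the second makes division by X harmless.
      p∣numB/X : p ∣num B/m X
      p∣numB/X = ∈⇒∣num (cancel-∈ (∤X pPrime (ℕ.n∣m*n (suc l))) (subst (_∈𝔭^ 1)
        (trans (sym (B/m*m X 2≤X)) (ℚ.*-comm (B/m X) (fromℕ X)))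
        (subst (λ x → B x ∈𝔭^ 1) (sym X≡) (Kummer.kummer 4≤n 2∣n l (suc l) 2∣l
          (ℕ.>⇒∤ l<n) (ℕ.>⇒∤ (m≤n⇒m≤1+n l<n)) (∣num⇒∈ p∣B)))))
        where
        open Localization pPrime
        open Residues pPrime

      p∤1+l : ¬ p ∣ suc l
      p∤1+l = ℕ.>⇒∤ (m≤n⇒m≤1+n (<⇒≤ l<n))

    -- Here m - 1 = kp + (suc l - k), so p ∣ m - 1 forces p ∣ suc l - k; for k < suc l that is a
    -- positive number below p.
    X-lower-bound : ∀ {m} → ASet p (2 + l) m → X ≤ m
    X-lower-bound {m} ((k , refl) , Q≡p) = subst (_≤ m) (sym X≡) (+-monoʳ-≤ (2 + l) (*-monoˡ-≤ n (≮⇒≥ k≮1+l)))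
      where
      k≮1+l : ¬ k < suc l
      k≮1+l k<1+l = contradiction (ℕ.∣m+n∣m⇒∣n (subst (p ∣_) shift (Q≡p⇒p∣m-1 m (m≤m+n 2 _) pPrime Q≡p)) (ℕ.n∣m*n k))
        (ℕ.>⇒∤ {{ℕ.>-nonZero (m<n⇒0<n∸m k<1+l)}} (≤-<-trans (m∸n≤m (suc l) k) (m≤n⇒m≤1+n (<⇒≤ l<n))))
        where
        open ℕ-Solver
        shift : suc (l + k * n) ≡ k * p + (suc l ∸ k)
        shift = trans (cong (_+ k * n) (sym (m+[n∸m]≡n (<⇒≤ k<1+l))))
          (solve 3 (λ k d n → k :+ d :+ k :* n := k :* (con 1 :+ n) :+ d) refl k (suc l ∸ k) n)

    -- `coprime⇒Q≡p` asks about all primes dividing `suc l`. These are odd because `2 + l` is even,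
    -- and one that divided the numerator would be irregular by `irregularPrime`, so testing
    -- irregular primes covers all of them.
    X-min : (∀ q → IrregularPrime q → q ∣ suc l → ¬ q ∣num B/m X) → IsMin (ASet p (2 + l)) X
    X-min h = ((suc l , X≡) , coprime⇒Q≡p X 2≤X (B≢0 X 2∣X) X-1≡ p∣numB/X coprime) , λ _ → X-lower-bound
      where
      coprime : ∀ q → Prime q → q ∣ suc l → ¬ q ∣num B/m X
      coprime q qPrime q∣1+l q∣num = h q (irregularPrime q X (qPrime , odd) 2∣X
        (∤X qPrime (ℕ.∣m⇒∣m*n p q∣1+l)) (B-from-num qPrime q∣num)) q∣1+l q∣num
        where
        odd : ¬ 2 ∣ q
        odd 2∣q = odd∤ (ℕ.∣-trans 2∣q q∣1+l) 2∣l

    X-min⁻ : IsMin (ASet p (2 + l)) X → ∀ q → IrregularPrime q → q ∣ suc l → ¬ q ∣num B/m X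
    X-min⁻ ((_ , Q≡p) , _) q ((qPrime , _) , _) = Q≡p⇒coprime X 2≤X pPrime X-1≡ p∤1+l Q≡p qPrime

open import Data.Nat using (ℕ; _+_; _*_; _∸_; _≤_)
open import Data.Nat.Divisibility using (_∣_)
open import Data.Product using (_×_)
open import Data.Sum using (_⊎_)
open import Function.Bundles using (_⇔_)
open import Relation.Nullary using (¬_)
open LeastIndex
open import Data.Nat using (zero; suc; s≤s)
open import Data.Nat.Divisibility using (_∣0)
open import Data.Product using (_,_; proj₁; proj₂)
open import Data.Sum using (inj₂; [_,_]′)
open import Function using (_∘_)
open import Function.Bundles using (mk⇔)
open import Relation.Nullary using (contradiction)

theorem2p1 : ∀ (p l : ℕ) → IrregularPair p l →
    let X = (l ∸ 1) * p + 1 in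
    (∀ a → IsMin (ASet p l) a → X ≤ a)
    × (IsMin (ASet p l) X
    ⇔ ((∀ q → IrregularPrime q → ¬ q ∣ (l ∸ 1))
    ⊎ (∀ q → IrregularPrime q → q ∣ (l ∸ 1) → ¬ q ∣num (B X ÷₀ fromℕ X))))
theorem2p1 zero    l (odd , _) = contradiction (2 ∣0) (proj₂ odd)
theorem2p1 (suc n) (suc (suc l)) irr = (λ a min → X-lower-bound irr (proj₁ min)) ,
  mk⇔ (inj₂ ∘ X-min⁻ irr)
    [ (λ h → X-min irr λ q qIrr q∣ → contradiction q∣ (h q qIrr)) , X-min irr ]′
theorem2p1 (suc n) zero       (_ , _ , () , _)
theorem2p1 (suc n) (suc zero) (_ , _ , s≤s () , _)
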